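{- Let $m\ge 3$, $n\ge 3$, let $x,y$ be two distinct vertices of the cycle $C_m$ with $p=d(x,y)$ (graph distance in $C_m$), and let $F_n(C_m)$ be the generalized sunflower graph formed from $n$ copies of $C_m$ with marked vertices $x,y$. The Kirchhoff index of $F_n(C_m)$ is $$Kf(F_n(C_m))=\frac{n(pm-p^2)\left(n^2(m-1)^2+m^2(4-6n)+6mn-1\right)}{12m}-\frac{n\left(m^3+m-2-2n(m-1)^2(m+1)\right)}{12}.$$
   Context: For a connected graph $H$ with vertex set $\{1,\dots,N\}$ and Laplacian matrix $L$, the resistance distance between vertices $i,j$ is $r_H(i,j)=(e_i-e_j)^T L^\dagger (e_i-e_j)$, where $e_i$ is the $i$th standard unit vector and $L^\dagger$ is the Moore–Penrose pseudoinverse of $L$. The Kirchhoff index is $Kf(H)=\frac12\sum_{i,j\in V(H)} r_H(i,j)$ (sum over ordered pairs). Generalized sunflower graph: fix distinct vertices $x,y$ of the cycle $C_m$. $F_n(C_m)$ is obtained from $n$ vertex-disjoint copies of $C_m$, labelled $1,\dots,n$, with $x_i,y_i$ the copies of $x,y$ in the $i$th copy, by identifying $y_i$ with $x_{i+1}$ for $1\le i<n$ and $y_n$ with $x_1$. -}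

module Defs where

open import Data.Fin using (Fin; zero; suc; toℕ; combine; punchIn; punchOut)
import Data.Fin.Properties as Fin
open import Data.Nat as ℕ using (ℕ; zero; suc; pred; s≤s; z≤n)
import Data.Nat.DivMod as ℕ
import Data.Nat.Properties as ℕ
open import Data.Product using (∃; _×_; _,_; proj₁; proj₂)
open import Data.Rational as ℚ using (ℚ; 0ℚ; 1ℚ; ½; _+_; _*_; _-_; 1/_)
import Data.Rational.Properties as ℚ
open import Data.Rational.Solver using (module +-*-Solver)
open import Data.Sum using (_⊎_; inj₁; inj₂; swap)
open import Data.Vec.Functional using (Vector; head; tail; transpose)
open import Algebra.Bundles using (CommutativeRing)
open import Algebra.Properties.Semiring.Sum
  (CommutativeRing.semiring ℚ.+-*-commutativeRing)
  using (sum; sum-cong-≗; sum-syntax; ∑-distrib-+; ∑-comm; sum-replicate-zero;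
         *-distribˡ-sum; *-distribʳ-sum)
open import Data.Bool using (if_then_else_)
open import Level using (0ℓ)
open import Relation.Binary using (Rel; Decidable; Symmetric; Irreflexive)
open import Relation.Binary.Construct.Closure.Equivalence using (EqClosure)
import Relation.Binary.Construct.Closure.Equivalence as EqC
open import Relation.Binary.PropositionalEquality
open import Relation.Nullary using (Dec; yes; no; does; contradiction)
open import Relation.Nullary.Decidable using (_×-dec_; _⊎-dec_)
open ≡-Reasoning

Matrix : ℕ → ℕ → Set
Matrix r c = Vector (Vector ℚ c) r

infix  8 _·_
infixr 9 _*ᵥ_
infixl 7 _⊗_

_·_ : ∀ {n} → Vector ℚ n → Vector ℚ n → ℚ
_·_ {n} u v = ∑[ i < n ] (u i * v i)

_*ᵥ_ : ∀ {r c} → Matrix r c → Vector ℚ c → Vector ℚ r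
(A *ᵥ v) i = A i · v

_⊗_ : ∀ {r s t} → Matrix r s → Matrix s t → Matrix r t
(A ⊗ B) i k = A i · transpose B k

-- The four Penrose equations.  They have at most one solution X, and for
-- rational A the solution over ℝ (or ℂ) has rational entries.
record IsMoorePenroseInverse {r c} (A : Matrix r c) (X : Matrix c r) : Set where
  field
    AXA≗A : ∀ i j → ((A ⊗ X) ⊗ A) i j ≡ A i j
    XAX≗X : ∀ i j → ((X ⊗ A) ⊗ X) i j ≡ X i j
    AX-symmetric : ∀ i j → transpose (A ⊗ X) i j ≡ (A ⊗ X) i j
    XA-symmetric : ∀ i j → transpose (X ⊗ A) i j ≡ (X ⊗ A) i j

open +-*-Solver

·-cong : ∀ {n} {u u′ v v′ : Vector ℚ n} →
         (∀ i → u i ≡ u′ i) → (∀ i → v i ≡ v′ i) → u · v ≡ u′ · v′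
·-cong p q = sum-cong-≗ λ i → cong₂ _*_ (p i) (q i)

·-comm : ∀ {n} (u v : Vector ℚ n) → u · v ≡ v · u
·-comm u v = sum-cong-≗ λ i → ℚ.*-comm (u i) (v i)

·-zeroˡ : ∀ {n} (v : Vector ℚ n) → (λ _ → 0ℚ) · v ≡ 0ℚ
·-zeroˡ {n} v = trans (sum-cong-≗ λ i → ℚ.*-zeroˡ (v i)) (sum-replicate-zero n)

·-scaleˡ : ∀ {n} s (u v : Vector ℚ n) → (λ i → s * u i) · v ≡ s * (u · v)
·-scaleˡ s u v = trans (sum-cong-≗ λ i → ℚ.*-assoc s (u i) (v i))
                       (sym (*-distribˡ-sum s (λ i → u i * v i)))

·-subˡ : ∀ {n} (u w v : Vector ℚ n) s →
         (λ i → u i - s * w i) · v ≡ u · v - s * (w · v)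
·-subˡ u w v s = begin
  (λ i → u i - s * w i) · v
    ≡⟨ sum-cong-≗ (λ i → solve 4 (λ a b c t → (a :- t :* b) :* c := a :* c :+ (:- t) :* (b :* c)) refl (u i) (w i) (v i) s) ⟩
  sum (λ i → u i * v i + (ℚ.- s) * (w i * v i))
    ≡⟨ ∑-distrib-+ (λ i → u i * v i) (λ i → (ℚ.- s) * (w i * v i)) ⟩
  u · v + sum (λ i → (ℚ.- s) * (w i * v i))
    ≡⟨ cong (u · v +_) (sym (*-distribˡ-sum (ℚ.- s) (λ i → w i * v i))) ⟩
  u · v + (ℚ.- s) * (w · v)
    ≡⟨ solve 3 (λ a b t → a :+ (:- t) :* b := a :- t :* b) refl (u · v) (w · v) s ⟩
  u · v - s * (w · v) ∎

·-subʳ : ∀ {n} (u w v : Vector ℚ n) s →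
         v · (λ i → u i - w i * s) ≡ v · u - (v · w) * s
·-subʳ u w v s = begin
  v · (λ i → u i - w i * s) ≡⟨ ·-comm v _ ⟩
  (λ i → u i - w i * s) · v ≡⟨ ·-cong (λ i → cong (λ z → u i - z) (ℚ.*-comm (w i) s)) (λ _ → refl) ⟩
  (λ i → u i - s * w i) · v ≡⟨ ·-subˡ u w v s ⟩
  u · v - s * (w · v)       ≡⟨ cong₂ (λ a b → a - b) (·-comm u v) (trans (ℚ.*-comm s _) (cong (_* s) (·-comm w v))) ⟩
  v · u - (v · w) * s       ∎

·-assoc : ∀ {r c} (u : Vector ℚ r) (A : Matrix r c) (v : Vector ℚ c) →
          (λ j → u · transpose A j) · v ≡ u · (A *ᵥ v)
·-assoc {r} {c} u A v = begin
  ∑[ j < c ] ((u · transpose A j) * v j)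
    ≡⟨ sum-cong-≗ (λ j → *-distribʳ-sum (v j) (λ i → u i * A i j)) ⟩
  ∑[ j < c ] ∑[ i < r ] (u i * A i j * v j)
    ≡⟨ ∑-comm (λ j i → u i * A i j * v j) ⟩
  ∑[ i < r ] ∑[ j < c ] (u i * A i j * v j)
    ≡⟨ sum-cong-≗ (λ i → trans (sum-cong-≗ λ j → ℚ.*-assoc (u i) (A i j) (v j))
                               (sym (*-distribˡ-sum (u i) (λ j → A i j * v j)))) ⟩
  u · (A *ᵥ v) ∎

⊗-assoc : ∀ {q r s t} (A : Matrix q r) (B : Matrix r s) (C : Matrix s t) →
          ∀ i k → ((A ⊗ B) ⊗ C) i k ≡ (A ⊗ (B ⊗ C)) i k
⊗-assoc A B C i k = ·-assoc (A i) B (transpose C k)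

square-nonNeg : ∀ p → 0ℚ ℚ.≤ p * p
square-nonNeg p with ℚ.≤-total 0ℚ p
... | inj₁ 0≤p = ℚ.nonNegative⁻¹ _ {{ℚ.nonNeg*nonNeg⇒nonNeg p {{ℚ.nonNegative 0≤p}} p {{ℚ.nonNegative 0≤p}}}}
... | inj₂ p≤0 = ℚ.nonNegative⁻¹ _ {{ℚ.nonPos*nonPos⇒nonPos p {{ℚ.nonPositive p≤0}} p {{ℚ.nonPositive p≤0}}}}

square≡0 : ∀ p → p * p ≡ 0ℚ → p ≡ 0ℚ
square≡0 p pp≡0 with p ℚ.≟ 0ℚ
... | yes p≡0 = p≡0
... | no  p≢0 = begin
  p                ≡⟨ sym (ℚ.*-identityˡ p) ⟩
  1ℚ * p           ≡⟨ cong (_* p) (sym (ℚ.*-inverseˡ p)) ⟩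
  (1/ p) * p * p   ≡⟨ ℚ.*-assoc (1/ p) p p ⟩
  (1/ p) * (p * p) ≡⟨ cong ((1/ p) *_) pp≡0 ⟩
  (1/ p) * 0ℚ      ≡⟨ ℚ.*-zeroʳ (1/ p) ⟩
  0ℚ               ∎
  where instance _ = ℚ.≢-nonZero p≢0

·-self-nonNeg : ∀ {n} (u : Vector ℚ n) → 0ℚ ℚ.≤ u · u
·-self-nonNeg {zero}  u = ℚ.≤-refl
·-self-nonNeg {suc n} u = ℚ.+-mono-≤ (square-nonNeg (head u)) (·-self-nonNeg (tail u))

sum≡0ˡ : ∀ {p q} → 0ℚ ℚ.≤ p → 0ℚ ℚ.≤ q → p + q ≡ 0ℚ → p ≡ 0ℚ
sum≡0ˡ {p} {q} 0≤p 0≤q p+q≡0 = ℚ.≤-antisym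
  (subst₂ ℚ._≤_ (ℚ.+-identityʳ p) p+q≡0 (ℚ.+-monoʳ-≤ p 0≤q)) 0≤p

·-self≡0 : ∀ {n} (u : Vector ℚ n) → u · u ≡ 0ℚ → ∀ i → u i ≡ 0ℚ
·-self≡0 {suc n} u uu≡0 zero =
  square≡0 (u zero) (sum≡0ˡ (square-nonNeg (u zero)) (·-self-nonNeg (tail u)) uu≡0)
·-self≡0 {suc n} u uu≡0 (suc i) =
  ·-self≡0 (tail u) (sum≡0ˡ (·-self-nonNeg (tail u)) (square-nonNeg (u zero))
                            (trans (ℚ.+-comm (tail u · tail u) _) uu≡0)) i

1+·-self-nonZero : ∀ {n} (u : Vector ℚ n) → ℚ.NonZero (1ℚ + u · u)
1+·-self-nonZero u = ℚ.>-nonZero (ℚ.+-mono-<-≤ (ℚ.positive⁻¹ 1ℚ) (·-self-nonNeg u))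

-- Greville's recursion: from X = A† to the pseudoinverse of B = [ a | A ].
module Greville {r c} (B : Matrix r (suc c))
                (X : Matrix c r)
                (mp : IsMoorePenroseInverse (λ i → tail (B i)) X) where
  open IsMoorePenroseInverse mp

  A : Matrix r c
  A i = tail (B i)

  a : Vector ℚ r
  a i = head (B i)

  d : Vector ℚ c
  d = X *ᵥ a

  e : Vector ℚ r
  e i = a i - (A *ᵥ d) i

  extend : Vector ℚ r → Matrix (suc c) r
  extend b zero    = b
  extend b (suc j) = λ i → X j i - d j * b i

  XAd≗d : ∀ j → (λ l → (X ⊗ A) j l) · d ≡ d j
  XAd≗d j = begin
    (λ l → (X ⊗ A) j l) · (X *ᵥ a)  ≡⟨ sym (·-assoc ((X ⊗ A) j) X a) ⟩
    ((X ⊗ A) ⊗ X) j · a             ≡⟨ ·-cong (XAX≗X j) (λ _ → refl) ⟩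
    d j                             ∎

  B⊗extend : ∀ b i k → (B ⊗ extend b) i k ≡ (A ⊗ X) i k + e i * b k
  B⊗extend b i k = begin
    a i * b k + A i · (λ j → X j k - d j * b k)
      ≡⟨ cong (a i * b k +_) (·-subʳ (λ j → X j k) d (A i) (b k)) ⟩
    a i * b k + ((A ⊗ X) i k - (A *ᵥ d) i * b k)
      ≡⟨ solve 4 (λ α β γ δ → α :* β :+ (γ :- δ :* β) := γ :+ (α :- δ) :* β) refl
                 (a i) (b k) ((A ⊗ X) i k) ((A *ᵥ d) i) ⟩
    (A ⊗ X) i k + e i * b k ∎

  extend⊗B : ∀ b j k → (extend b ⊗ B) (suc j) k ≡ X j · transpose B k - d j * (b · transpose B k)
  extend⊗B b j k = ·-subˡ (X j) b (transpose B k) (d j)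

  module Independent (ee≢0 : e · e ≢ 0ℚ) where
    instance _ = ℚ.≢-nonZero ee≢0

    s : ℚ
    s = 1/ (e · e)

    b : Vector ℚ r
    b i = s * e i

    eA≗0 : ∀ k → e · transpose A k ≡ 0ℚ
    eA≗0 k = begin
      e · transpose A k
        ≡⟨ ·-cong (λ i → cong (λ z → a i - z) (trans (sym (·-assoc (A i) X a)) (sym (ℚ.*-identityˡ _)))) (λ _ → refl) ⟩
      (λ i → a i - 1ℚ * ((A ⊗ X) *ᵥ a) i) · transpose A k
        ≡⟨ ·-subˡ a ((A ⊗ X) *ᵥ a) (transpose A k) 1ℚ ⟩
      a · transpose A k - 1ℚ * (((A ⊗ X) *ᵥ a) · transpose A k)
        ≡⟨ cong (λ z → a · transpose A k - 1ℚ * z) (begin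
             ((A ⊗ X) *ᵥ a) · transpose A k
               ≡⟨ ·-cong (λ i → trans (·-cong (λ j → sym (AX-symmetric i j)) (λ _ → refl)) (·-comm _ a)) (λ _ → refl) ⟩
             (λ i → a · transpose (A ⊗ X) i) · transpose A k
               ≡⟨ ·-assoc a (A ⊗ X) (transpose A k) ⟩
             a · ((A ⊗ X) *ᵥ transpose A k)
               ≡⟨ ·-cong {u = a} (λ _ → refl) (λ i → AXA≗A i k) ⟩
             a · transpose A k ∎) ⟩
      a · transpose A k - 1ℚ * (a · transpose A k)
        ≡⟨ solve 1 (λ z → z :- con 1ℚ :* z := con 0ℚ) refl (a · transpose A k) ⟩
      0ℚ ∎

    ea≡ee : e · a ≡ e · e
    ea≡ee = begin
      e · a
        ≡⟨ solve 1 (λ z → z := z :- con 0ℚ :* con 1ℚ) refl (e · a) ⟩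
      e · a - 0ℚ * 1ℚ
        ≡⟨ cong (λ z → e · a - z * 1ℚ) (sym eAd≡0) ⟩
      e · a - (e · (A *ᵥ d)) * 1ℚ
        ≡⟨ sym (·-subʳ a (A *ᵥ d) e 1ℚ) ⟩
      e · (λ i → a i - (A *ᵥ d) i * 1ℚ)
        ≡⟨ ·-cong {u = e} (λ _ → refl) (λ i → cong (λ z → a i - z) (ℚ.*-identityʳ _)) ⟩
      e · e ∎
      where
      eAd≡0 : e · (A *ᵥ d) ≡ 0ℚ
      eAd≡0 = trans (sym (·-assoc e A d)) (trans (·-cong eA≗0 (λ _ → refl)) (·-zeroˡ d))

    ba≡1 : b · a ≡ 1ℚ
    ba≡1 = trans (·-scaleˡ s e a) (trans (cong (s *_) ea≡ee) (ℚ.*-inverseˡ (e · e)))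

    bA≗0 : ∀ k → b · transpose A k ≡ 0ℚ
    bA≗0 k = trans (·-scaleˡ s e _) (trans (cong (s *_) (eA≗0 k)) (ℚ.*-zeroʳ s))

    D : Matrix (suc c) (suc c)
    D zero    zero    = 1ℚ
    D zero    (suc k) = 0ℚ
    D (suc j) zero    = 0ℚ
    D (suc j) (suc k) = (X ⊗ A) j k

    XB≗D : ∀ j k → (extend b ⊗ B) j k ≡ D j k
    XB≗D zero    zero    = ba≡1
    XB≗D zero    (suc k) = bA≗0 k
    XB≗D (suc j) zero    = trans (extend⊗B b j zero) (trans
      (cong (λ z → d j - d j * z) ba≡1)
      (solve 1 (λ z → z :- z :* con 1ℚ := con 0ℚ) refl (d j)))
    XB≗D (suc j) (suc k) = trans (extend⊗B b j (suc k)) (trans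
      (cong (λ z → (X ⊗ A) j k - d j * z) (bA≗0 k))
      (solve 2 (λ y z → y :- z :* con 0ℚ := y) refl ((X ⊗ A) j k) (d j)))

    D-symmetric : ∀ j k → transpose D j k ≡ D j k
    D-symmetric zero    zero    = refl
    D-symmetric zero    (suc k) = refl
    D-symmetric (suc j) zero    = refl
    D-symmetric (suc j) (suc k) = XA-symmetric j k

    BD≗B : ∀ i k → (B ⊗ D) i k ≡ B i k
    BD≗B i zero = trans
      (cong₂ _+_ (ℚ.*-identityʳ (a i)) (trans (·-comm (A i) _) (·-zeroˡ (A i))))
      (ℚ.+-identityʳ (a i))
    BD≗B i (suc k) = trans
      (cong₂ _+_ (ℚ.*-zeroʳ (a i)) (trans (sym (⊗-assoc A X A i k)) (AXA≗A i k)))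
      (ℚ.+-identityˡ (A i k))

    DX≗X : ∀ j k → (D ⊗ extend b) j k ≡ extend b j k
    DX≗X zero k = trans
      (cong₂ _+_ (ℚ.*-identityˡ (b k)) (·-zeroˡ (λ j → X j k - d j * b k)))
      (ℚ.+-identityʳ (b k))
    DX≗X (suc j) k = begin
      0ℚ * b k + (X ⊗ A) j · (λ l → X l k - d l * b k)
        ≡⟨ cong₂ _+_ (ℚ.*-zeroˡ (b k)) (·-subʳ (λ l → X l k) d ((X ⊗ A) j) (b k)) ⟩
      0ℚ + (((X ⊗ A) ⊗ X) j k - ((X ⊗ A) j · d) * b k)
        ≡⟨ ℚ.+-identityˡ _ ⟩
      ((X ⊗ A) ⊗ X) j k - ((X ⊗ A) j · d) * b k
        ≡⟨ cong₂ (λ y z → y - z * b k) (XAX≗X j k) (XAd≗d j) ⟩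
      X j k - d j * b k ∎

    isMP : IsMoorePenroseInverse B (extend b)
    isMP = record
      { AXA≗A = λ i k → trans (⊗-assoc B (extend b) B i k)
          (trans (·-cong {u = B i} (λ _ → refl) (λ j → XB≗D j k)) (BD≗B i k))
      ; XAX≗X = λ j k → trans (·-cong {v = λ l → extend b l k} (XB≗D j) (λ _ → refl)) (DX≗X j k)
      ; AX-symmetric = λ i k → begin
          (B ⊗ extend b) k i           ≡⟨ B⊗extend b k i ⟩
          (A ⊗ X) k i + e k * (s * e i) ≡⟨ cong₂ _+_ (AX-symmetric i k)
               (solve 3 (λ x y z → x :* (y :* z) := z :* (y :* x)) refl (e k) s (e i)) ⟩
          (A ⊗ X) i k + e i * (s * e k) ≡⟨ sym (B⊗extend b i k) ⟩
          (B ⊗ extend b) i k           ∎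
      ; XA-symmetric = λ j k → trans (XB≗D k j) (trans (D-symmetric j k) (sym (XB≗D j k)))
      }

  module Dependent (e≗0 : ∀ i → e i ≡ 0ℚ) where
    instance _ = 1+·-self-nonZero d

    t s : ℚ
    t = d · d
    s = 1/ (1ℚ + t)

    b : Vector ℚ r
    b i = s * (d · transpose X i)

    Ad≗a : ∀ i → (A *ᵥ d) i ≡ a i
    Ad≗a i = begin
      (A *ᵥ d) i ≡⟨ solve 2 (λ x y → y := x :- (x :- y)) refl (a i) ((A *ᵥ d) i) ⟩
      a i - e i  ≡⟨ cong (λ z → a i - z) (e≗0 i) ⟩
      a i - 0ℚ   ≡⟨ solve 1 (λ x → x :- con 0ℚ := x) refl (a i) ⟩
      a i        ∎

    BX≗AX : ∀ i k → (B ⊗ extend b) i k ≡ (A ⊗ X) i k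
    BX≗AX i k = trans (B⊗extend b i k) (trans
      (cong (λ z → (A ⊗ X) i k + z * b k) (e≗0 i))
      (solve 2 (λ x y → x :+ con 0ℚ :* y := x) refl ((A ⊗ X) i k) (b k)))

    bv : ∀ v → b · v ≡ s * (d · (X *ᵥ v))
    bv v = trans (·-scaleˡ s (λ i → d · transpose X i) v) (cong (s *_) (·-assoc d X v))

    ba≡st : b · a ≡ s * t
    ba≡st = bv a

    bA≗sd : ∀ k → b · transpose A k ≡ s * d k
    bA≗sd k = trans (bv (transpose A k)) (cong (s *_) (begin
      d · (λ j → (X ⊗ A) j k) ≡⟨ ·-comm d _ ⟩
      (λ j → (X ⊗ A) j k) · d ≡⟨ ·-cong (λ j → XA-symmetric k j) (λ _ → refl) ⟩
      (X ⊗ A) k · d           ≡⟨ XAd≗d k ⟩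
      d k                     ∎))

    D : Matrix (suc c) (suc c)
    D zero    zero    = s * t
    D zero    (suc k) = s * d k
    D (suc j) zero    = s * d j
    D (suc j) (suc k) = (X ⊗ A) j k - d j * (s * d k)

    XB≗D : ∀ j k → (extend b ⊗ B) j k ≡ D j k
    XB≗D zero    zero    = ba≡st
    XB≗D zero    (suc k) = bA≗sd k
    XB≗D (suc j) zero    = begin
      (extend b ⊗ B) (suc j) zero ≡⟨ extend⊗B b j zero ⟩
      d j - d j * (b · a)         ≡⟨ cong (λ z → d j - d j * z) ba≡st ⟩
      d j - d j * (s * t)         ≡⟨ solve 3 (λ x y z → x :- x :* (y :* z) := x :- x :* (y :* (con 1ℚ :+ z)) :+ y :* x) refl (d j) s t ⟩
      d j - d j * (s * (1ℚ + t)) + s * d j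
                                  ≡⟨ cong (λ z → d j - d j * z + s * d j) (ℚ.*-inverseˡ (1ℚ + t)) ⟩
      d j - d j * 1ℚ + s * d j    ≡⟨ solve 2 (λ x y → x :- x :* con 1ℚ :+ y :* x := y :* x) refl (d j) s ⟩
      s * d j                     ∎
    XB≗D (suc j) (suc k) = trans (extend⊗B b j (suc k))
      (cong (λ z → (X ⊗ A) j k - d j * z) (bA≗sd k))

    D-symmetric : ∀ j k → transpose D j k ≡ D j k
    D-symmetric zero    zero    = refl
    D-symmetric zero    (suc k) = refl
    D-symmetric (suc j) zero    = refl
    D-symmetric (suc j) (suc k) = cong₂ _-_ (XA-symmetric j k)
      (solve 3 (λ x y z → x :* (y :* z) := z :* (y :* x)) refl (d k) s (d j))

    AXB≗B : ∀ i k → (A ⊗ X) i · transpose B k ≡ B i k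
    AXB≗B i zero    = trans (·-assoc (A i) X a) (Ad≗a i)
    AXB≗B i (suc k) = AXA≗A i k

    XAX≗X′ : ∀ j k → X j · transpose (A ⊗ X) k ≡ X j k
    XAX≗X′ j k = trans (sym (⊗-assoc X A X j k)) (XAX≗X j k)

    bAX≗b : ∀ k → b · transpose (A ⊗ X) k ≡ b k
    bAX≗b k = trans (bv (transpose (A ⊗ X) k))
      (cong (s *_) (·-cong {u = d} (λ _ → refl) (λ j → XAX≗X′ j k)))

    XAX≗ : ∀ j k → (extend b ⊗ (A ⊗ X)) j k ≡ extend b j k
    XAX≗ zero    k = bAX≗b k
    XAX≗ (suc j) k = trans (·-subˡ (X j) b (transpose (A ⊗ X) k) (d j))
      (cong₂ (λ y z → y - d j * z) (XAX≗X′ j k) (bAX≗b k))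

    isMP : IsMoorePenroseInverse B (extend b)
    isMP = record
      { AXA≗A = λ i k → trans (·-cong (BX≗AX i) (λ _ → refl)) (AXB≗B i k)
      ; XAX≗X = λ j k → trans (⊗-assoc (extend b) B (extend b) j k)
          (trans (·-cong {u = extend b j} (λ _ → refl) (λ i → BX≗AX i k)) (XAX≗ j k))
      ; AX-symmetric = λ i k → trans (BX≗AX k i) (trans (AX-symmetric i k) (sym (BX≗AX i k)))
      ; XA-symmetric = λ j k → trans (XB≗D k j) (trans (D-symmetric j k) (sym (XB≗D j k)))
      }

abstract
  moorePenroseInverse : ∀ {r c} (A : Matrix r c) → ∃ (IsMoorePenroseInverse A)
  moorePenroseInverse {r} {zero} A = (λ ()) , record
    { AXA≗A = λ _ () ; XAX≗X = λ () ; AX-symmetric = λ _ _ → refl ; XA-symmetric = λ () }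
  moorePenroseInverse {r} {suc c} B with moorePenroseInverse (λ i → tail (B i))
  ... | X , mp with Greville.e B X mp · Greville.e B X mp ℚ.≟ 0ℚ
  ...   | no  ee≢0 = _ , Greville.Independent.isMP B X mp ee≢0
  ...   | yes ee≡0 = _ , Greville.Dependent.isMP B X mp (·-self≡0 (Greville.e B X mp) ee≡0)

infix 10 _†

_† : ∀ {r c} → Matrix r c → Matrix c r
A † = proj₁ (moorePenroseInverse A)

†-isMoorePenroseInverse : ∀ {r c} (A : Matrix r c) → IsMoorePenroseInverse A (A †)
†-isMoorePenroseInverse A = proj₂ (moorePenroseInverse A)

record Graph (N : ℕ) : Set₁ where
  field
    Adj     : Rel (Fin N) 0ℓ
    _adj?_  : Decidable Adj
    sym-Adj : Symmetric Adj
    irrefl  : Irreflexive _≡_ Adj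

𝟙 : {P : Set} → Dec P → ℚ
𝟙 P? = if does P? then 1ℚ else 0ℚ

module _ {N : ℕ} (G : Graph N) where
  open Graph G

  adjacency : Matrix N N
  adjacency u v = 𝟙 (u adj? v)

  degree : Vector ℚ N
  degree u = ∑[ v < N ] adjacency u v

  laplacian : Matrix N N
  laplacian u v = 𝟙 (u Fin.≟ v) * degree u - adjacency u v

  unit : Fin N → Vector ℚ N
  unit i j = 𝟙 (i Fin.≟ j)

  resistance : Fin N → Fin N → ℚ
  resistance i j = eᵢ-eⱼ · (laplacian † *ᵥ eᵢ-eⱼ)
    where
    eᵢ-eⱼ : Vector ℚ N
    eᵢ-eⱼ k = unit i k - unit j k

  Kf : ℚ
  Kf = ½ * (∑[ i < N ] ∑[ j < N ] resistance i j)

  data Walk : Fin N → Fin N → ℕ → Set where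
    []  : ∀ {u} → Walk u u 0
    _∷_ : ∀ {u v w k} → Adj u v → Walk v w k → Walk u w (suc k)

  IsDistance : Fin N → Fin N → ℕ → Set
  IsDistance u v d = Walk u v d × (∀ k → Walk u v k → d ℕ.≤ k)

next : ∀ {n} → Fin n → Fin n
next {suc n} i = suc (toℕ i) ℕ.mod suc n

next≢ : ∀ {n} → 2 ℕ.≤ n → (i : Fin n) → next i ≢ i
next≢ {suc (suc n)} (s≤s (s≤s z≤n)) i eq with suc (toℕ i) ℕ.<? suc (suc n)
... | yes i+1<n = ℕ.1+n≢n (begin
        suc (toℕ i)                     ≡⟨ sym (ℕ.m<n⇒m%n≡m i+1<n) ⟩
        suc (toℕ i) ℕ.% suc (suc n)     ≡⟨ sym (Fin.toℕ-fromℕ< _) ⟩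
        toℕ (next i)                    ≡⟨ cong toℕ eq ⟩
        toℕ i                           ∎)
... | no  i+1≮n = contradiction (begin
        0                               ≡⟨ sym (ℕ.n%n≡0 (suc (suc n))) ⟩
        suc (suc n) ℕ.% suc (suc n)     ≡⟨ cong (ℕ._% suc (suc n)) (sym i+1≡n) ⟩
        suc (toℕ i) ℕ.% suc (suc n)     ≡⟨ sym (Fin.toℕ-fromℕ< _) ⟩
        toℕ (next i)                    ≡⟨ cong toℕ eq ⟩
        toℕ i                           ≡⟨ ℕ.suc-injective i+1≡n ⟩
        suc n                           ∎) λ ()
  where
  i+1≡n : suc (toℕ i) ≡ suc (suc n)
  i+1≡n = ℕ.≤-antisym (Fin.toℕ<n i) (ℕ.≮⇒≥ i+1≮n)

2≤ : ∀ {n} → 3 ℕ.≤ n → 2 ℕ.≤ n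
2≤ = ℕ.≤-trans (s≤s (s≤s z≤n))

cycle : (m : ℕ) → 3 ℕ.≤ m → Graph m
cycle m 3≤m = record
  { Adj     = λ u v → next u ≡ v ⊎ next v ≡ u
  ; _adj?_  = λ u v → (next u Fin.≟ v) ⊎-dec (next v Fin.≟ u)
  ; sym-Adj = swap
  ; irrefl  = λ { {u} refl (inj₁ p) → next≢ (2≤ 3≤m) u p ; {u} refl (inj₂ p) → next≢ (2≤ 3≤m) u p }
  }

-- Vertex a ≢ y of copy i.  As y_i is identified with x_{i+1} (cyclically),
-- these n (m - 1) vertices represent every class exactly once.
vertex : ∀ {m n} {y : Fin m} → Fin n → (a : Fin m) → y ≢ a → Fin (n ℕ.* pred m)
vertex {suc m} i a y≢a = combine i (punchOut y≢a)

module Gluing {m n : ℕ} (x y : Fin m) (x≢y : x ≢ y) where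

  glue : Fin n × Fin m → Fin (n ℕ.* pred m)
  glue (i , a) with y Fin.≟ a
  ... | yes _   = vertex (next i) x (≢-sym x≢y)
  ... | no  y≢a = vertex i a y≢a

  data Identified : Rel (Fin n × Fin m) 0ℓ where
    yᵢ~xᵢ₊₁ : ∀ i → Identified (i , y) (next i , x)

  vertex-injective : ∀ {m} {y : Fin m} {i j : Fin n} {a b : Fin m} (p : y ≢ a) (q : y ≢ b) →
                     vertex i a p ≡ vertex j b q → (i , a) ≡ (j , b)
  vertex-injective {suc m} {y} {i} {j} p q eq =
    cong₂ _,_ (proj₁ inj) (Fin.punchOut-injective p q (proj₂ inj))
    where inj = Fin.combine-injective i (punchOut p) j (punchOut q) eq

  vertex-cong : ∀ {m} {y : Fin m} {i : Fin n} {a : Fin m} (p q : y ≢ a) →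
                vertex i a p ≡ vertex i a q
  vertex-cong {suc m} {y} {i} p q = cong (combine i) (Fin.punchOut-cong y refl)

  vertex-surjective : ∀ {m} (y : Fin m) (v : Fin (n ℕ.* pred m)) →
                      ∃ λ (i : Fin n) → ∃ λ a → ∃ λ (p : y ≢ a) → vertex i a p ≡ v
  vertex-surjective {suc m} y v with Fin.combine-surjective {n} {m} v
  ... | i , k , eq = i , punchIn y k , (λ p → Fin.punchInᵢ≢i y k (sym p)) ,
                     trans (cong (combine i) (Fin.punchOut-punchIn y)) eq

  glue-vertex : ∀ {i a} (p : y ≢ a) → glue (i , a) ≡ vertex i a p
  glue-vertex {i} {a} p with y Fin.≟ a
  ... | yes y≡a = contradiction y≡a p
  ... | no  q   = vertex-cong q p

  representative : ∀ s → ∃ λ i → ∃ λ a → ∃ λ (p : y ≢ a) →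
                   EqClosure Identified s (i , a) × glue s ≡ vertex i a p
  representative (i , a) with y Fin.≟ a
  ... | yes refl = next i , x , ≢-sym x≢y , EqC.return (yᵢ~xᵢ₊₁ i) , refl
  ... | no  y≢a  = i , a , y≢a , EqC.reflexive Identified , refl

  -- glue is the quotient map of the identification.
  glue-surjective : ∀ v → ∃ λ s → glue s ≡ v
  glue-surjective v with vertex-surjective y v
  ... | i , a , p , eq = (i , a) , trans (glue-vertex p) eq

  glue-respects : ∀ {s t} → EqClosure Identified s t → glue s ≡ glue t
  glue-respects = EqC.gfold isEquivalence glue glue-step
    where
    glue-step : ∀ {s t} → Identified s t → glue s ≡ glue t
    glue-step (yᵢ~xᵢ₊₁ i) with y Fin.≟ y
    ... | yes _   = sym (glue-vertex (≢-sym x≢y))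
    ... | no  y≢y = contradiction refl y≢y

  glue-reflects : ∀ {s t} → glue s ≡ glue t → EqClosure Identified s t
  glue-reflects {s} {t} eq with representative s | representative t
  ... | i , a , p , s~ia , s≡ | j , b , q , t~jb , t≡ =
    EqC.transitive Identified s~ia
      (subst (λ z → EqClosure Identified z t)
             (sym (vertex-injective p q (trans (sym s≡) (trans eq t≡))))
             (EqC.symmetric Identified t~jb))

  glue-injective-copy : 2 ℕ.≤ n → ∀ i {a b} → glue (i , a) ≡ glue (i , b) → a ≡ b
  glue-injective-copy 2≤n i {a} {b} eq with y Fin.≟ a | y Fin.≟ b
  ... | yes y≡a | yes y≡b = trans (sym y≡a) y≡b
  ... | yes _   | no  y≢b = contradiction (cong proj₁ (vertex-injective (≢-sym x≢y) y≢b eq)) (next≢ 2≤n i)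
  ... | no  y≢a | yes _   = contradiction (cong proj₁ (sym (vertex-injective y≢a (≢-sym x≢y) eq))) (next≢ 2≤n i)
  ... | no  y≢a | no  y≢b = cong proj₂ (vertex-injective y≢a y≢b eq)

sunflower : (m n : ℕ) → 3 ℕ.≤ m → 3 ℕ.≤ n → (x y : Fin m) → x ≢ y → Graph (n ℕ.* pred m)
sunflower m n 3≤m 3≤n x y x≢y = record
  { Adj     = λ u v → ∃ λ i → ∃ λ a → ∃ λ b → Adj a b × glue (i , a) ≡ u × glue (i , b) ≡ v
  ; _adj?_  = λ u v → Fin.any? λ i → Fin.any? λ a → Fin.any? λ b →
                (a adj? b) ×-dec (glue (i , a) Fin.≟ u) ×-dec (glue (i , b) Fin.≟ v)
  ; sym-Adj = λ { (i , a , b , ab , p , q) → i , b , a , sym-Adj ab , q , p }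
  ; irrefl  = λ { refl (i , a , b , ab , p , q) →
                irrefl (glue-injective-copy (2≤ 3≤n) i (trans p (sym q))) ab }
  }
  where
  open Graph (cycle m 3≤m)
  open Gluing {m} {n} x y x≢y

12*m≢0 : ∀ {m} → 3 ℕ.≤ m → ℕ.NonZero (12 ℕ.* m)
12*m≢0 (s≤s _) = _

{-# OPTIONS --safe #-}

-- If a matrix R with zero diagonal satisfies (L R) u v = τ u - 2 [u = v] for some vector τ, then
-- (R_j - R_i) / 2 is a potential for the unit current from i to j, and Kf is half the sum of all entries of R.
-- In the cycle C_m, R = r with r(d) = d - d²/m has this property.  The sunflower is a ring of n copies of
-- C_m, each of resistance ρ = r(x, y) between its terminals, so series composition and one correction for
-- closing the ring express its R through r, the resistances q of C_n and the voltage φ = (r_x - r_y + ρ)/2.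
-- The sums of r and of (r_x - r_y)² needed to add up all entries come from summation by parts against the
-- function m r² + 2 r, whose Laplacian is 12 r plus a constant.

module Submission where

open import Defs

-- The matrix `R` comes from circuit reduction, but it is only verified: it suffices that its
-- columns solve a Poisson equation. For a point `a` of one copy, `σ a`, `φ a` and `ρ - φ a` are the
-- legs of the star that replaces the network with terminals `a`, `x`, `y`; between different copies
-- these legs lie in series along the ring. The obstacle is that a glued vertex belongs to two
-- copies, so computing its row of the Laplacian directly splits into cases. Instead the row is
-- expressed through the indicator `w` of the vertex, pulled back to all copies. It becomes a sum of
-- Dirichlet forms of single cycles, and the gluing enters only through `w i y ≡ w (next i) x`. The
-- constant 2 in `m r² + 2 r`: the Laplacian of `m r²` leaves a point source of strength 4 at the
-- base vertex, and that of `2 r` cancels it.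

module KirchhoffIndex where

  open import Data.Fin using (Fin; zero; suc; toℕ; fromℕ; inject₁; punchIn; combine; _↑ˡ_; _↑ʳ_)
  import Data.Fin.Properties as Fin
  open import Data.Integer as ℤ using (ℤ; +_)
  import Data.Integer.Properties as ℤ
  open import Data.Nat as ℕ using (ℕ; zero; suc)
  import Data.Nat.Properties as ℕ
  import Data.Nat.DivMod as ℕ
  open import Data.Product using (∃; _×_; _,_; proj₁; proj₂)
  open import Data.Rational as ℚ using (ℚ; 0ℚ; 1ℚ; ½; _+_; _*_; _-_; -_; _/_)
  import Data.Rational.Properties as ℚ
  open import Data.Rational.Solver using (module +-*-Solver)
  import Data.Rational.Unnormalised as ℚᵘ
  import Data.Rational.Unnormalised.Properties as ℚᵘ
  open import Data.Sum using (_⊎_; inj₁; inj₂)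
  open import Data.Vec.Functional using (Vector)
  open import Algebra.Bundles using (CommutativeRing)
  open import Algebra.Properties.Semiring.Sum
    (CommutativeRing.semiring ℚ.+-*-commutativeRing)
    using (sum; sum-cong-≗; sum-syntax; ∑-distrib-+; ∑-comm; sum-init-last; sum-remove;
           *-distribˡ-sum; *-distribʳ-sum)
  open import Function using (_∘_)
  open import Relation.Binary.PropositionalEquality
  open import Relation.Nullary using (Dec; yes; no; ¬_; contradiction)
  open import Relation.Nullary.Decidable using (_×-dec_; _⊎-dec_)
  open import Relation.Unary using (Pred; Decidable)
  open ≡-Reasoning
  open +-*-Solver

  -- Indicators and finite sums

  𝟙-yes : {P : Set} (P? : Dec P) → P → 𝟙 P? ≡ 1ℚ
  𝟙-yes (yes _) _ = refl
  𝟙-yes (no ¬p) p = contradiction p ¬p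

  𝟙-no : {P : Set} (P? : Dec P) → ¬ P → 𝟙 P? ≡ 0ℚ
  𝟙-no (yes p) ¬p = contradiction p ¬p
  𝟙-no (no _)  _  = refl

  𝟙-cong : {P Q : Set} (P? : Dec P) (Q? : Dec Q) → (P → Q) → (Q → P) → 𝟙 P? ≡ 𝟙 Q?
  𝟙-cong (yes p) Q? f g = sym (𝟙-yes Q? (f p))
  𝟙-cong (no ¬p) Q? f g = sym (𝟙-no Q? (¬p ∘ g))

  𝟙-× : {P Q : Set} (P? : Dec P) (Q? : Dec Q) → 𝟙 (P? ×-dec Q?) ≡ 𝟙 P? * 𝟙 Q?
  𝟙-× (yes _) (yes _) = refl
  𝟙-× (yes _) (no  _) = refl
  𝟙-× (no  _) Q?      = sym (ℚ.*-zeroˡ (𝟙 Q?))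

  𝟙-⊎ : {P Q : Set} (P? : Dec P) (Q? : Dec Q) → ¬ (P × Q) → 𝟙 (P? ⊎-dec Q?) ≡ 𝟙 P? + 𝟙 Q?
  𝟙-⊎ (yes p) (yes q) ¬pq = contradiction (p , q) ¬pq
  𝟙-⊎ (yes _) (no  _) _   = refl
  𝟙-⊎ (no  _) (yes _) _   = refl
  𝟙-⊎ (no  _) (no  _) _   = refl

  ∑-distrib-- : ∀ {n} (f g : Vector ℚ n) → ∑[ i < n ] (f i - g i) ≡ ∑[ i < n ] f i - ∑[ i < n ] g i
  ∑-distrib-- {zero}  f g = refl
  ∑-distrib-- {suc n} f g = trans (cong (_+_ (f zero - g zero)) (∑-distrib-- (f ∘ suc) (g ∘ suc)))
    (solve 4 (λ a b c d → (a :- b) :+ (c :- d) := (a :+ c) :- (b :+ d)) refl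
       (f zero) (g zero) (sum (f ∘ suc)) (sum (g ∘ suc)))

  ∑-𝟙 : ∀ {n} (i : Fin n) (f : Vector ℚ n) → ∑[ j < n ] (𝟙 (i Fin.≟ j) * f j) ≡ f i
  ∑-𝟙 {suc n} zero f = trans (cong₂ _+_ (ℚ.*-identityˡ (f zero)) (·-zeroˡ (f ∘ suc))) (ℚ.+-identityʳ _)
  ∑-𝟙 {suc n} (suc i) f = trans (cong₂ _+_ (ℚ.*-zeroˡ (f zero)) (∑-𝟙 i (f ∘ suc))) (ℚ.+-identityˡ _)

  -- Turns an existential in the adjacency relation into a sum, which can then be interchanged with
  -- other sums. The right side counts witnesses, hence the uniqueness.
  𝟙-any : ∀ {n} {P : Pred (Fin n) _} (P? : Decidable P) → (∀ {i j} → P i → P j → i ≡ j) →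
          𝟙 (Fin.any? P?) ≡ ∑[ i < n ] 𝟙 (P? i)
  𝟙-any {n} {P} P? unique with Fin.any? P?
  ... | yes (i , p) = sym (begin
    ∑[ j < n ] 𝟙 (P? j)               ≡⟨ sum-cong-≗ (λ j → trans
      (𝟙-cong (P? j) (i Fin.≟ j) (unique p) (λ i≡j → subst P i≡j p)) (sym (ℚ.*-identityʳ _))) ⟩
    ∑[ j < n ] (𝟙 (i Fin.≟ j) * 1ℚ)   ≡⟨ ∑-𝟙 i (λ _ → 1ℚ) ⟩
    1ℚ                                ∎)
  ... | no ¬p = sym (begin
    ∑[ j < n ] 𝟙 (P? j)         ≡⟨ sum-cong-≗ (λ j → trans (𝟙-no (P? j) λ p → ¬p (j , p)) (sym (ℚ.*-zeroˡ 1ℚ))) ⟩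
    ∑[ j < n ] (0ℚ * 1ℚ)        ≡⟨ ·-zeroˡ {n} (λ _ → 1ℚ) ⟩
    0ℚ                          ∎)

  -- The cyclic successor

  data NextView {n : ℕ} (c : Fin n) : Set where
    step : suc (toℕ c) ℕ.< n → toℕ (next c) ≡ suc (toℕ c) → NextView c
    wrap : suc (toℕ c) ≡ n → toℕ (next c) ≡ 0 → NextView c

  nextView : ∀ {n} (c : Fin n) → NextView c
  nextView {suc n} c with suc (toℕ c) ℕ.<? suc n
  ... | yes c+1<n = step c+1<n (trans (Fin.toℕ-fromℕ< _) (ℕ.m<n⇒m%n≡m c+1<n))
  ... | no  c+1≮n = wrap c+1≡n (trans (Fin.toℕ-fromℕ< _) (trans (cong (ℕ._% suc n) c+1≡n) (ℕ.n%n≡0 (suc n))))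
    where
    c+1≡n : suc (toℕ c) ≡ suc n
    c+1≡n = ℕ.≤-antisym (Fin.toℕ<n c) (ℕ.≮⇒≥ c+1≮n)

  -- `next` rotates the indices: it acts as `suc` on all but the last one and sends that one to
  -- `zero`. Splitting off the last term on the left thus matches splitting off the first on the
  -- right.
  ∑-next : ∀ {n} (f : Vector ℚ n) → ∑[ c < n ] f (next c) ≡ ∑[ c < n ] f c
  ∑-next {zero}  f = refl
  ∑-next {suc n} f = begin
    ∑[ c < suc n ] f (next c)                                ≡⟨ sum-init-last (f ∘ next) ⟩
    ∑[ c < n ] f (next (inject₁ c)) + f (next (fromℕ n))     ≡⟨ cong₂ _+_ (sum-cong-≗ (cong f ∘ next-inject₁)) (cong f next-fromℕ) ⟩
    ∑[ c < n ] f (suc c) + f zero                            ≡⟨ ℚ.+-comm _ (f zero) ⟩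
    f zero + ∑[ c < n ] f (suc c)                            ∎
    where
    next-inject₁ : ∀ c → next (inject₁ c) ≡ suc c
    next-inject₁ c with nextView (inject₁ c)
    ... | step _ eq = Fin.toℕ-injective (trans eq (cong suc (Fin.toℕ-inject₁ c)))
    ... | wrap eq _ = contradiction (trans (sym (Fin.toℕ-inject₁ c)) (ℕ.suc-injective eq)) (ℕ.<⇒≢ (Fin.toℕ<n c))
    next-fromℕ : next (fromℕ n) ≡ zero
    next-fromℕ with nextView (fromℕ n)
    ... | step lt _ = contradiction (subst (λ z → suc z ℕ.< suc n) (Fin.toℕ-fromℕ n) lt) (ℕ.n≮n (suc n))
    ... | wrap _ eq = Fin.toℕ-injective eq

  -- Casts into ℚ

  ℤ→ℚ : ℤ → ℚ
  ℤ→ℚ i = i / 1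

  ι : ℕ → ℚ
  ι n = ℤ→ℚ (+ n)

  -- Arithmetic on ℚ normalises by a gcd, which is stuck on variables. The cast laws are therefore
  -- transferred to unnormalised fractions, where equality is cross multiplication.
  toℚᵘ-/ : ∀ i d .{{_ : ℕ.NonZero d}} → ℚ.toℚᵘ (i / d) ℚᵘ.≃ i ℚᵘ./ d
  toℚᵘ-/ i (suc d) = ℚ.toℚᵘ-fromℚᵘ (ℚᵘ.mkℚᵘ i d)

  ℤ→ℚ-+ : ∀ i j → ℤ→ℚ (i ℤ.+ j) ≡ ℤ→ℚ i + ℤ→ℚ j
  ℤ→ℚ-+ i j = ℚ.toℚᵘ-injective (ℚᵘ.≃-trans (toℚᵘ-/ (i ℤ.+ j) 1) (ℚᵘ.≃-sym (ℚᵘ.≃-trans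
    (ℚ.toℚᵘ-homo-+ (ℤ→ℚ i) (ℤ→ℚ j)) (ℚᵘ.≃-trans (ℚᵘ.+-cong (toℚᵘ-/ i 1) (toℚᵘ-/ j 1))
    (ℚᵘ.≃-reflexive (cong (ℚᵘ._/ 1) (cong₂ ℤ._+_ (ℤ.*-identityʳ i) (ℤ.*-identityʳ j))))))))

  ℤ→ℚ-* : ∀ i j → ℤ→ℚ (i ℤ.* j) ≡ ℤ→ℚ i * ℤ→ℚ j
  ℤ→ℚ-* i j = ℚ.toℚᵘ-injective (ℚᵘ.≃-trans (toℚᵘ-/ (i ℤ.* j) 1) (ℚᵘ.≃-sym (ℚᵘ.≃-trans
    (ℚ.toℚᵘ-homo-* (ℤ→ℚ i) (ℤ→ℚ j)) (ℚᵘ.*-cong (toℚᵘ-/ i 1) (toℚᵘ-/ j 1)))))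

  ℤ→ℚ-neg : ∀ i → ℤ→ℚ (ℤ.- i) ≡ - ℤ→ℚ i
  ℤ→ℚ-neg i = ℚ.toℚᵘ-injective (ℚᵘ.≃-trans (toℚᵘ-/ (ℤ.- i) 1) (ℚᵘ.≃-sym (ℚᵘ.≃-trans
    (ℚ.toℚᵘ-homo‿- (ℤ→ℚ i)) (ℚᵘ.-‿cong (toℚᵘ-/ i 1)))))

  /-* : ∀ i d .{{_ : ℕ.NonZero d}} → (i / d) * ι d ≡ ℤ→ℚ i
  /-* i d@(suc _) = ℚ.toℚᵘ-injective (ℚᵘ.≃-trans (ℚ.toℚᵘ-homo-* (i / d) (ι d))
    (ℚᵘ.≃-trans (ℚᵘ.*-cong (toℚᵘ-/ i d) (toℚᵘ-/ (+ d) 1)) (ℚᵘ.≃-trans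
    (ℚᵘ.*≡* (trans (ℤ.*-identityʳ _) (cong (λ e → i ℤ.* + e) (sym (ℕ.*-identityʳ d))))) (ℚᵘ.≃-sym (toℚᵘ-/ i 1)))))

  ι-+ : ∀ a b → ι (a ℕ.+ b) ≡ ι a + ι b
  ι-+ a b = ℤ→ℚ-+ (+ a) (+ b)

  ι-suc : ∀ a → ι (suc a) ≡ 1ℚ + ι a
  ι-suc = ι-+ 1

  ι-* : ∀ a b → ι (a ℕ.* b) ≡ ι a * ι b
  ι-* a b = trans (cong ℤ→ℚ (ℤ.pos-* a b)) (ℤ→ℚ-* (+ a) (+ b))

  ∑-const : ∀ n x → ∑[ i < n ] x ≡ ι n * x
  ∑-const zero    x = sym (ℚ.*-zeroˡ x)
  ∑-const (suc n) x = begin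
    x + ∑[ i < n ] x ≡⟨ cong (_+_ x) (∑-const n x) ⟩
    x + ι n * x      ≡⟨ solve 2 (λ x k → x :+ k :* x := (con 1ℚ :+ k) :* x) refl x (ι n) ⟩
    (1ℚ + ι n) * x   ≡⟨ cong (_* x) (sym (ι-suc n)) ⟩
    ι (suc n) * x    ∎

  _⁻¹ : ∀ n .{{_ : ℕ.NonZero n}} → ℚ
  n ⁻¹ = + 1 / n

  *-inverse : ∀ n .{{_ : ℕ.NonZero n}} → ι n * n ⁻¹ ≡ 1ℚ
  *-inverse n = trans (ℚ.*-comm (ι n) (n ⁻¹)) (/-* (+ 1) n)

  -- The ring solver takes no hypotheses. An equation that holds only because `p ≡ q` is given to it
  -- with an explicit multiple of `p - q` added, and `c` is that cofactor. Nested uses certify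
  -- membership in the ideal generated by several hypotheses.
  modulo : ∀ {x y p q} c → p ≡ q → x ≡ y + c * (p - q) → x ≡ y
  modulo {x} {y} {p} c refl eq = trans eq (solve 3 (λ y c p → y :+ c :* (p :- p) := y) refl y c p)

  -- Resistances in a cycle

  -- The value 1 on the diagonal is the right one for forward differences, because a step away from
  -- `b` increases the distance.
  sgn : ℕ → ℕ → ℚ
  sgn a b = ι 2 * 𝟙 (b ℕ.≤? a) - 1ℚ

  sgn-≥ : ∀ {a b} → b ℕ.≤ a → sgn a b ≡ 1ℚ
  sgn-≥ {a} {b} b≤a = cong (λ z → ι 2 * z - 1ℚ) (𝟙-yes (b ℕ.≤? a) b≤a)

  sgn-< : ∀ {a b} → a ℕ.< b → sgn a b ≡ - 1ℚ
  sgn-< {a} {b} a<b = cong (λ z → ι 2 * z - 1ℚ) (𝟙-no (b ℕ.≤? a) (ℕ.<⇒≱ a<b))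

  dist-≥ : ∀ {a b} → b ℕ.≤ a → ι ℕ.∣ a - b ∣ ≡ ι a - ι b
  dist-≥ {a} {b} b≤a = begin
    ι ℕ.∣ a - b ∣               ≡⟨ cong ι (ℕ.m≤n⇒∣n-m∣≡n∸m b≤a) ⟩
    ι (a ℕ.∸ b)                 ≡⟨ solve 2 (λ k b → k := k :+ b :- b) refl (ι (a ℕ.∸ b)) (ι b) ⟩
    ι (a ℕ.∸ b) + ι b - ι b     ≡⟨ cong (_- ι b) (trans (sym (ι-+ (a ℕ.∸ b) b)) (cong ι (ℕ.m∸n+n≡m b≤a))) ⟩
    ι a - ι b                   ∎

  dist≡sgn* : ∀ a b → ι ℕ.∣ a - b ∣ ≡ sgn a b * (ι a - ι b)
  dist≡sgn* a b with ℕ.≤-<-connex b a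
  ... | inj₁ b≤a = begin
    ι ℕ.∣ a - b ∣           ≡⟨ dist-≥ b≤a ⟩
    ι a - ι b               ≡⟨ sym (ℚ.*-identityˡ _) ⟩
    1ℚ * (ι a - ι b)        ≡⟨ cong (_* (ι a - ι b)) (sym (sgn-≥ b≤a)) ⟩
    sgn a b * (ι a - ι b)   ∎
  ... | inj₂ a<b = begin
    ι ℕ.∣ a - b ∣           ≡⟨ cong ι (ℕ.∣-∣-comm a b) ⟩
    ι ℕ.∣ b - a ∣           ≡⟨ dist-≥ (ℕ.<⇒≤ a<b) ⟩
    ι b - ι a               ≡⟨ solve 2 (λ a b → b :- a := con (- 1ℚ) :* (a :- b)) refl (ι a) (ι b) ⟩
    - 1ℚ * (ι a - ι b)      ≡⟨ cong (_* (ι a - ι b)) (sym (sgn-< a<b)) ⟩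
    sgn a b * (ι a - ι b)   ∎

  sgn² : ∀ a b → sgn a b * sgn a b ≡ 1ℚ
  sgn² a b with ℕ.≤-<-connex b a
  ... | inj₁ b≤a = cong₂ _*_ (sgn-≥ b≤a) (sgn-≥ b≤a)
  ... | inj₂ a<b = cong₂ _*_ (sgn-< a<b) (sgn-< a<b)

  module CycleResistance (n : ℕ) .{{_ : ℕ.NonZero n}} where

    resistanceAt : ℕ → ℚ
    resistanceAt d = ι d - ι d * ι d * n ⁻¹

    r : Fin n → Fin n → ℚ
    r a b = resistanceAt ℕ.∣ toℕ a - toℕ b ∣

    t s : Fin n → Fin n → ℚ
    t a b = ι (toℕ a) - ι (toℕ b)
    s a b = sgn (toℕ a) (toℕ b)

    r-sym : ∀ a b → r a b ≡ r b a
    r-sym a b = cong resistanceAt (ℕ.∣-∣-comm (toℕ a) (toℕ b))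

    r-diag : ∀ a → r a a ≡ 0ℚ
    r-diag a = trans (cong resistanceAt (ℕ.∣n-n∣≡0 (toℕ a)))
      (cong (_-_ 0ℚ) (ℚ.*-zeroˡ (n ⁻¹)))

    -- As `s` squares to 1, the sign survives only in the linear term, and all that follows is
    -- polynomial in `s` and `t`.
    r≡ : ∀ a b → r a b ≡ s a b * t a b - t a b * t a b * n ⁻¹
    r≡ a b = begin
      r a b                                             ≡⟨ cong₂ (λ x y → x - x * y * n ⁻¹) d≡ d≡ ⟩
      s a b * t a b - s a b * t a b * (s a b * t a b) * n ⁻¹
        ≡⟨ modulo (- (t a b * t a b * n ⁻¹)) (sgn² (toℕ a) (toℕ b))
             (solve 3 (λ s t v → s :* t :- s :* t :* (s :* t) :* v :=
                s :* t :- t :* t :* v :+ (:- (t :* t :* v)) :* (s :* s :- con 1ℚ)) refl (s a b) (t a b) (n ⁻¹)) ⟩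
      s a b * t a b - t a b * t a b * n ⁻¹              ∎
      where
      d≡ = dist≡sgn* (toℕ a) (toℕ b)

    t-step : ∀ c b → toℕ (next c) ≡ suc (toℕ c) → t (next c) b ≡ 1ℚ + t c b
    t-step c b eq = trans (cong (λ z → z - ι (toℕ b)) (trans (cong ι eq) (ι-suc (toℕ c))))
      (solve 2 (λ a b → con 1ℚ :+ a :- b := con 1ℚ :+ (a :- b)) refl (ι (toℕ c)) (ι (toℕ b)))

    t-wrap : ∀ c b → suc (toℕ c) ≡ n → toℕ (next c) ≡ 0 → t (next c) b ≡ 1ℚ + t c b - ι n
    t-wrap c b c+1≡n eq = trans (cong (λ z → ι z - ι (toℕ b)) eq)
      (trans (solve 2 (λ c b → con 0ℚ :- b := con 1ℚ :+ (c :- b) :- (con 1ℚ :+ c)) refl (ι (toℕ c)) (ι (toℕ b)))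
      (cong (λ z → 1ℚ + t c b - z) (trans (sym (ι-suc (toℕ c))) (cong ι c+1≡n))))

    s-last : ∀ c b → suc (toℕ c) ≡ n → s c b ≡ 1ℚ
    s-last c b c+1≡n = sgn-≥ (ℕ.s≤s⁻¹ (subst (toℕ b ℕ.<_) (sym c+1≡n) (Fin.toℕ<n b)))

    D : Fin n → Fin n → ℚ
    D c b = s c b - (t c b + t c b + 1ℚ) * n ⁻¹

    r-next : ∀ c b → r (next c) b ≡ r c b + D c b
    r-next c b = trans (r≡ (next c) b) (trans (helper (nextView c)) (cong (_+ D c b) (sym (r≡ c b))))
      where
      helper : NextView c →
        s (next c) b * t (next c) b - t (next c) b * t (next c) b * n ⁻¹ ≡
        s c b * t c b - t c b * t c b * n ⁻¹ + D c b
      helper (step _ eq) = begin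
        s (next c) b * t (next c) b - t (next c) b * t (next c) b * n ⁻¹
          ≡⟨ cong₂ (λ x y → x - y * y * n ⁻¹) st≡ t≡ ⟩
        s c b * (1ℚ + t c b) - (1ℚ + t c b) * (1ℚ + t c b) * n ⁻¹
          ≡⟨ solve 3 (λ s t v → s :* (con 1ℚ :+ t) :- (con 1ℚ :+ t) :* (con 1ℚ :+ t) :* v :=
               s :* t :- t :* t :* v :+ (s :- (t :+ t :+ con 1ℚ) :* v)) refl (s c b) (t c b) (n ⁻¹) ⟩
        s c b * t c b - t c b * t c b * n ⁻¹ + D c b ∎
        where
        t≡ : t (next c) b ≡ 1ℚ + t c b
        t≡ = t-step c b eq
        st≡ : s (next c) b * t (next c) b ≡ s c b * (1ℚ + t c b)
        st≡ with ℕ.≤-<-connex (toℕ b) (toℕ c)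
        ... | inj₁ b≤c = cong₂ _*_ (trans (sgn-≥ (subst (toℕ b ℕ.≤_) (sym eq) (ℕ.m≤n⇒m≤1+n b≤c))) (sym (sgn-≥ b≤c))) t≡
        ... | inj₂ c<b with ℕ.m≤n⇒m<n∨m≡n c<b
        ...   | inj₁ c+1<b = cong₂ _*_ (trans (sgn-< (subst (ℕ._< toℕ b) (sym eq) c+1<b)) (sym (sgn-< c<b))) t≡
        -- The sign flips only on arrival at `b`, where the factor `t` vanishes, so the old sign may
        -- be kept.
        ...   | inj₂ c+1≡b = begin
          s (next c) b * t (next c) b ≡⟨ cong (s (next c) b *_) t≡0 ⟩
          s (next c) b * 0ℚ           ≡⟨ trans (ℚ.*-zeroʳ (s (next c) b)) (sym (ℚ.*-zeroʳ (s c b))) ⟩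
          s c b * 0ℚ                  ≡⟨ cong (s c b *_) (trans (sym t≡0) t≡) ⟩
          s c b * (1ℚ + t c b)        ∎
          where
          t≡0 : t (next c) b ≡ 0ℚ
          t≡0 = trans (cong (λ z → ι z - ι (toℕ b)) (trans eq c+1≡b)) (ℚ.+-inverseʳ (ι (toℕ b)))
      -- At the wrap the new distance is `n - (1 + t)` instead of `1 + t`, and `d - d²/n` is
      -- invariant under `d ↦ n - d`.
      helper (wrap c+1≡n eq) = begin
        s (next c) b * t (next c) b - t (next c) b * t (next c) b * n ⁻¹
          ≡⟨ cong₂ (λ x y → x - y * y * n ⁻¹) st≡ t≡ ⟩
        ι n - (1ℚ + t c b) - (1ℚ + t c b - ι n) * (1ℚ + t c b - ι n) * n ⁻¹
          ≡⟨ modulo (1ℚ + 1ℚ + t c b + t c b - ι n) (*-inverse n)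
             (solve 3 (λ t m v → m :- (con 1ℚ :+ t) :- (con 1ℚ :+ t :- m) :* (con 1ℚ :+ t :- m) :* v :=
               con 1ℚ :* t :- t :* t :* v :+ (con 1ℚ :- (t :+ t :+ con 1ℚ) :* v)
               :+ (con 1ℚ :+ con 1ℚ :+ t :+ t :- m) :* (m :* v :- con 1ℚ)) refl (t c b) (ι n) (n ⁻¹)) ⟩
        1ℚ * t c b - t c b * t c b * n ⁻¹ + (1ℚ - (t c b + t c b + 1ℚ) * n ⁻¹)
          ≡⟨ cong (λ z → z * t c b - t c b * t c b * n ⁻¹ + (z - (t c b + t c b + 1ℚ) * n ⁻¹)) (sym s≡) ⟩
        s c b * t c b - t c b * t c b * n ⁻¹ + D c b ∎
        where
        s≡ : s c b ≡ 1ℚ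
        s≡ = s-last c b c+1≡n
        t≡ : t (next c) b ≡ 1ℚ + t c b - ι n
        t≡ = t-wrap c b c+1≡n eq
        st≡ : s (next c) b * t (next c) b ≡ ι n - (1ℚ + t c b)
        st≡ = begin
          s (next c) b * t (next c) b ≡⟨ sym (dist≡sgn* (toℕ (next c)) (toℕ b)) ⟩
          ι ℕ.∣ toℕ (next c) - toℕ b ∣ ≡⟨ cong (λ z → ι ℕ.∣ z - toℕ b ∣) eq ⟩
          ι (toℕ b)                   ≡⟨ solve 2 (λ b c → b := con 1ℚ :+ c :- (con 1ℚ :+ (c :- b))) refl (ι (toℕ b)) (ι (toℕ c)) ⟩
          1ℚ + ι (toℕ c) - (1ℚ + t c b) ≡⟨ cong (_- (1ℚ + t c b)) (trans (sym (ι-suc (toℕ c))) (cong ι c+1≡n)) ⟩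
          ι n - (1ℚ + t c b)          ∎

    -- The negated second difference of `r` at `next c`: the linear part of `D` contributes `2/n` at
    -- every step, and `s` jumps by 2 only on reaching `b`. At the wrap, the jump of `t` by `n`
    -- makes up for `s` falling from 1 to -1.
    D-next : ∀ c b → D c b - D (next c) b ≡ ι 2 * (n ⁻¹ - 𝟙 (next c Fin.≟ b))
    D-next c b with nextView c
    ... | step _ eq = begin
      D c b - D (next c) b
        ≡⟨ cong (λ z → D c b - (s (next c) b - (z + z + 1ℚ) * n ⁻¹)) t≡ ⟩
      D c b - (s (next c) b - (1ℚ + t c b + (1ℚ + t c b) + 1ℚ) * n ⁻¹)
        ≡⟨ solve 4 (λ s s′ t v → s :- (t :+ t :+ con 1ℚ) :* v :- (s′ :- (con 1ℚ :+ t :+ (con 1ℚ :+ t) :+ con 1ℚ) :* v)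
             := s :- s′ :+ con (ι 2) :* v) refl (s c b) (s (next c) b) (t c b) (n ⁻¹) ⟩
      s c b - s (next c) b + ι 2 * n ⁻¹
        ≡⟨ cong (_+ ι 2 * n ⁻¹) s≡ ⟩
      - (ι 2 * 𝟙 (next c Fin.≟ b)) + ι 2 * n ⁻¹
        ≡⟨ solve 2 (λ e v → :- (con (ι 2) :* e) :+ con (ι 2) :* v := con (ι 2) :* (v :- e)) refl (𝟙 (next c Fin.≟ b)) (n ⁻¹) ⟩
      ι 2 * (n ⁻¹ - 𝟙 (next c Fin.≟ b)) ∎
      where
      t≡ : t (next c) b ≡ 1ℚ + t c b
      t≡ = t-step c b eq
      s≡ : s c b - s (next c) b ≡ - (ι 2 * 𝟙 (next c Fin.≟ b))
      s≡ with ℕ.≤-<-connex (toℕ b) (toℕ c)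
      ... | inj₁ b≤c = trans
              (cong₂ _-_ (sgn-≥ b≤c) (sgn-≥ (subst (toℕ b ℕ.≤_) (sym eq) (ℕ.m≤n⇒m≤1+n b≤c))))
              (cong (λ y → - (ι 2 * y)) (sym (𝟙-no (next c Fin.≟ b)
                λ { refl → ℕ.1+n≰n (subst (ℕ._≤ toℕ c) eq b≤c) })))
      ... | inj₂ c<b with ℕ.m≤n⇒m<n∨m≡n c<b
      ...   | inj₁ c+1<b = trans (cong₂ _-_ (sgn-< c<b) (sgn-< next<b))
                (cong (λ y → - (ι 2 * y)) (sym (𝟙-no (next c Fin.≟ b) λ p → ℕ.<⇒≢ next<b (cong toℕ p))))
        where
        next<b = subst (ℕ._< toℕ b) (sym eq) c+1<b
      ...   | inj₂ c+1≡b = trans (cong₂ _-_ (sgn-< c<b) (sgn-≥ (ℕ.≤-reflexive (sym next≡b))))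
                (cong (λ y → - (ι 2 * y)) (sym (𝟙-yes (next c Fin.≟ b) (Fin.toℕ-injective next≡b))))
        where
        next≡b = trans eq c+1≡b
    ... | wrap c+1≡n eq = begin
      D c b - D (next c) b
        ≡⟨ cong₂ (λ x y → x - (t c b + t c b + 1ℚ) * n ⁻¹ - (s (next c) b - (y + y + 1ℚ) * n ⁻¹)) s≡ t≡ ⟩
      1ℚ - (t c b + t c b + 1ℚ) * n ⁻¹ - (s (next c) b - (1ℚ + t c b - ι n + (1ℚ + t c b - ι n) + 1ℚ) * n ⁻¹)
        ≡⟨ cong (λ x → 1ℚ - (t c b + t c b + 1ℚ) * n ⁻¹ - (x - (1ℚ + t c b - ι n + (1ℚ + t c b - ι n) + 1ℚ) * n ⁻¹)) s′≡ ⟩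
      1ℚ - (t c b + t c b + 1ℚ) * n ⁻¹ - (ι 2 * 𝟙 (next c Fin.≟ b) - 1ℚ - (1ℚ + t c b - ι n + (1ℚ + t c b - ι n) + 1ℚ) * n ⁻¹)
        ≡⟨ modulo (- ι 2) (*-inverse n)
          (solve 4 (λ e t m v → con 1ℚ :- (t :+ t :+ con 1ℚ) :* v
               :- (con (ι 2) :* e :- con 1ℚ :- (con 1ℚ :+ t :- m :+ (con 1ℚ :+ t :- m) :+ con 1ℚ) :* v)
             := con (ι 2) :* (v :- e) :+ (:- con (ι 2)) :* (m :* v :- con 1ℚ)) refl (𝟙 (next c Fin.≟ b)) (t c b) (ι n) (n ⁻¹)) ⟩
      ι 2 * (n ⁻¹ - 𝟙 (next c Fin.≟ b)) ∎
      where
      s≡ : s c b ≡ 1ℚ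
      s≡ = s-last c b c+1≡n
      t≡ : t (next c) b ≡ 1ℚ + t c b - ι n
      t≡ = t-wrap c b c+1≡n eq
      s′≡ : s (next c) b ≡ ι 2 * 𝟙 (next c Fin.≟ b) - 1ℚ
      s′≡ = cong (λ z → ι 2 * z - 1ℚ) (𝟙-cong (toℕ b ℕ.≤? toℕ (next c)) (next c Fin.≟ b)
        (λ b≤ → Fin.toℕ-injective (trans eq (sym (ℕ.n≤0⇒n≡0 (subst (toℕ b ℕ.≤_) eq b≤)))))
        (λ p → ℕ.≤-reflexive (cong toℕ (sym p))))

    -- D is the forward difference of r; this relation reduces the Laplacian of r² to that of r.
    D² : ∀ c b → (D c b + n ⁻¹) * (D c b + n ⁻¹) ≡ 1ℚ - ι 2 * ι 2 * r c b * n ⁻¹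
    D² c b = begin
      (D c b + n ⁻¹) * (D c b + n ⁻¹)
        ≡⟨ modulo 1ℚ (sgn² (toℕ c) (toℕ b)) (solve 3 (λ s t v →
             (s :- (t :+ t :+ con 1ℚ) :* v :+ v) :* (s :- (t :+ t :+ con 1ℚ) :* v :+ v) :=
             con 1ℚ :- con (ι 2) :* con (ι 2) :* (s :* t :- t :* t :* v) :* v
             :+ con 1ℚ :* (s :* s :- con 1ℚ)) refl (s c b) (t c b) (n ⁻¹)) ⟩
      1ℚ - ι 2 * ι 2 * (s c b * t c b - t c b * t c b * n ⁻¹) * n ⁻¹
        ≡⟨ cong (λ z → 1ℚ - ι 2 * ι 2 * z * n ⁻¹) (sym (r≡ c b)) ⟩
      1ℚ - ι 2 * ι 2 * r c b * n ⁻¹ ∎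

  -- The Dirichlet form of a cycle

  ∑-lin : ∀ {n} α β (f g : Vector ℚ n) → ∑[ i < n ] (α * f i + β * g i) ≡ α * ∑[ i < n ] f i + β * ∑[ i < n ] g i
  ∑-lin α β f g = trans (∑-distrib-+ (λ i → α * f i) (λ i → β * g i))
    (cong₂ _+_ (sym (*-distribˡ-sum α f)) (sym (*-distribˡ-sum β g)))

  𝓔 : ∀ {n} → Vector ℚ n → Vector ℚ n → ℚ
  𝓔 {n} w f = ∑[ c < n ] ((w (next c) - w c) * (f (next c) - f c))

  𝓔-sym : ∀ {n} (w f : Vector ℚ n) → 𝓔 w f ≡ 𝓔 f w
  𝓔-sym w f = sum-cong-≗ λ c → ℚ.*-comm (w (next c) - w c) (f (next c) - f c)

  𝓔-congʳ : ∀ {n} (w : Vector ℚ n) {f g : Vector ℚ n} → (∀ a → f a ≡ g a) → 𝓔 w f ≡ 𝓔 w g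
  𝓔-congʳ w f≗g = sum-cong-≗ λ c → cong₂ (λ y z → (w (next c) - w c) * (y - z)) (f≗g (next c)) (f≗g c)

  𝓔-lin : ∀ {n} (w : Vector ℚ n) α β k (f g : Vector ℚ n) →
          𝓔 w (λ a → α * f a + β * g a + k) ≡ α * 𝓔 w f + β * 𝓔 w g
  𝓔-lin w α β k f g = trans
    (sum-cong-≗ λ c → solve 9 (λ w′ w f′ f g′ g α β k →
       (w′ :- w) :* ((α :* f′ :+ β :* g′ :+ k) :- (α :* f :+ β :* g :+ k)) :=
       α :* ((w′ :- w) :* (f′ :- f)) :+ β :* ((w′ :- w) :* (g′ :- g))) refl
       (w (next c)) (w c) (f (next c)) (f c) (g (next c)) (g c) α β k)
    (∑-lin α β (λ c → (w (next c) - w c) * (f (next c) - f c)) (λ c → (w (next c) - w c) * (g (next c) - g c)))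

  𝓔-constˡ : ∀ {n} k (f : Vector ℚ n) → 𝓔 (λ _ → k) f ≡ 0ℚ
  𝓔-constˡ k f = trans (sum-cong-≗ λ c → cong (_* (f (next c) - f c)) (ℚ.+-inverseʳ k)) (·-zeroˡ (λ c → f (next c) - f c))

  -- The second difference is centred at `next c`, so that only successors occur and no predecessor
  -- function is required; `∑-next` restores the index afterwards.
  𝓔-by-parts : ∀ {n} (w f : Vector ℚ n) →
    𝓔 w f ≡ ∑[ c < n ] (w (next c) * ((f (next c) - f c) - (f (next (next c)) - f (next c))))
  𝓔-by-parts {n} w f = begin
    𝓔 w f
      ≡⟨ sum-cong-≗ (λ c → solve 3 (λ w′ w d → (w′ :- w) :* d := w′ :* d :- w :* d) refl (w (next c)) (w c) (d c)) ⟩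
    ∑[ c < n ] (w (next c) * d c - w c * d c)
      ≡⟨ ∑-distrib-- (λ c → w (next c) * d c) (λ c → w c * d c) ⟩
    ∑[ c < n ] (w (next c) * d c) - ∑[ c < n ] (w c * d c)
      ≡⟨ cong (_-_ (∑[ c < n ] (w (next c) * d c))) (sym (∑-next (λ c → w c * d c))) ⟩
    ∑[ c < n ] (w (next c) * d c) - ∑[ c < n ] (w (next c) * d (next c))
      ≡⟨ sym (∑-distrib-- (λ c → w (next c) * d c) (λ c → w (next c) * d (next c))) ⟩
    ∑[ c < n ] (w (next c) * d c - w (next c) * d (next c))
      ≡⟨ sum-cong-≗ (λ c → solve 3 (λ w d e → w :* d :- w :* e := w :* (d :- e)) refl (w (next c)) (d c) (d (next c))) ⟩
    ∑[ c < n ] (w (next c) * (d c - d (next c))) ∎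
    where
    d : Vector ℚ n
    d c = f (next c) - f c

  ∑-𝟙ʳ : ∀ {n} (i : Fin n) (f : Vector ℚ n) → ∑[ j < n ] (f j * 𝟙 (j Fin.≟ i)) ≡ f i
  ∑-𝟙ʳ i f = trans (sum-cong-≗ λ j → trans (ℚ.*-comm (f j) _)
    (cong (_* f j) (𝟙-cong (j Fin.≟ i) (i Fin.≟ j) sym sym))) (∑-𝟙 i f)

  -- `r₀`, `r₁`, `r₂` are consecutive values of `r`, and `δ` tells whether the middle one is taken
  -- at the base vertex. The Laplacian of `r²` is `2 r₁ (d - d′) - d² - d′²`; `h₁` and `h₂` make the
  -- squares linear in `r`, `h₅` removes `δ * r₁`, and the point source left over after
  -- multiplication by `n` cancels against that of `2 r`.
  biharmonic-algebra : ∀ n ν r₀ d d′ δ {r₁ r₂} → r₁ ≡ r₀ + d → r₂ ≡ r₁ + d′ →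
    (d + ν) * (d + ν) ≡ 1ℚ - ι 4 * r₀ * ν → (d′ + ν) * (d′ + ν) ≡ 1ℚ - ι 4 * r₁ * ν →
    d - d′ ≡ ι 2 * (ν - δ) → n * ν ≡ 1ℚ → δ * r₁ ≡ 0ℚ →
    ((n * (r₁ * r₁) + ι 2 * r₁) - (n * (r₀ * r₀) + ι 2 * r₀)) - ((n * (r₂ * r₂) + ι 2 * r₂) - (n * (r₁ * r₁) + ι 2 * r₁)) ≡
    ι 12 * r₁ - ι 2 * (n - ν)
  biharmonic-algebra n ν r₀ d d′ δ refl refl h₁ h₂ h₃ h₄ h₅ =
    modulo (- n) h₁ (modulo (- n) h₂ (modulo (ι 2 * n * (r₀ + d)) h₃
    (modulo (ι 12 * (r₀ + d) + ι 2 * ν - ι 2 * (d - d′)) h₄ (modulo (- (ι 4 * n)) h₅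
    (solve 6 (λ n ν r₀ d d′ δ →
      let r₁ = r₀ :+ d; r₂ = r₁ :+ d′; two = con (ι 2); four = con (ι 4); twelve = con (ι 12) in
      (n :* (r₁ :* r₁) :+ two :* r₁) :- (n :* (r₀ :* r₀) :+ two :* r₀) :- ((n :* (r₂ :* r₂) :+ two :* r₂) :- (n :* (r₁ :* r₁) :+ two :* r₁)) :=
      twelve :* r₁ :- two :* (n :- ν)
        :+ (:- n) :* ((d :+ ν) :* (d :+ ν) :- (con 1ℚ :- four :* r₀ :* ν))
        :+ (:- n) :* ((d′ :+ ν) :* (d′ :+ ν) :- (con 1ℚ :- four :* r₁ :* ν))
        :+ two :* n :* r₁ :* (d :- d′ :- two :* (ν :- δ))
        :+ (twelve :* r₁ :+ two :* ν :- two :* (d :- d′)) :* (n :* ν :- con 1ℚ)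
        :+ (:- (four :* n)) :* (δ :* r₁ :- con 0ℚ))
      refl n ν r₀ d d′ δ)))))

  module CycleForm (n : ℕ) .{{_ : ℕ.NonZero n}} where
    open CycleResistance n

    𝓔-r : ∀ w b → 𝓔 w (λ a → r a b) ≡ ι 2 * (n ⁻¹ * sum w - w b)
    𝓔-r w b = begin
      𝓔 w (λ a → r a b)
        ≡⟨ 𝓔-by-parts w (λ a → r a b) ⟩
      ∑[ c < n ] (w (next c) * ((r (next c) b - r c b) - (r (next (next c)) b - r (next c) b)))
        ≡⟨ sum-cong-≗ (λ c → cong (w (next c) *_) (trans (cong₂ _-_ (forward-difference c b) (forward-difference (next c) b)) (D-next c b))) ⟩
      ∑[ c < n ] (w (next c) * (ι 2 * (n ⁻¹ - 𝟙 (next c Fin.≟ b))))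
        ≡⟨ ∑-next (λ a → w a * (ι 2 * (n ⁻¹ - 𝟙 (a Fin.≟ b)))) ⟩
      ∑[ a < n ] (w a * (ι 2 * (n ⁻¹ - 𝟙 (a Fin.≟ b))))
        ≡⟨ sum-cong-≗ (λ a → solve 3 (λ w v e → w :* (con (ι 2) :* (v :- e)) :=
             con (ι 2) :* v :* w :+ con (- ι 2) :* (w :* e)) refl (w a) (n ⁻¹) (𝟙 (a Fin.≟ b))) ⟩
      ∑[ a < n ] (ι 2 * n ⁻¹ * w a + (- ι 2) * (w a * 𝟙 (a Fin.≟ b)))
        ≡⟨ ∑-lin (ι 2 * n ⁻¹) (- ι 2) w _ ⟩
      ι 2 * n ⁻¹ * sum w + (- ι 2) * ∑[ a < n ] (w a * 𝟙 (a Fin.≟ b))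
        ≡⟨ cong (λ z → ι 2 * n ⁻¹ * sum w + (- ι 2) * z) (∑-𝟙ʳ b w) ⟩
      ι 2 * n ⁻¹ * sum w + (- ι 2) * w b
        ≡⟨ solve 3 (λ v s w → con (ι 2) :* v :* s :+ con (- ι 2) :* w := con (ι 2) :* (v :* s :- w)) refl (n ⁻¹) (sum w) (w b) ⟩
      ι 2 * (n ⁻¹ * sum w - w b) ∎
      where
      forward-difference : ∀ c b → r (next c) b - r c b ≡ D c b
      forward-difference c b = trans (cong (_- r c b) (r-next c b)) (solve 2 (λ r d → r :+ d :- r := d) refl (r c b) (D c b))

    -- G/12 solves L s = r - mean of r.
    G : Fin n → Fin n → ℚ
    G a b = ι n * (r a b * r a b) + ι 2 * r a b

    𝓔-G : ∀ w b → 𝓔 w (λ a → G a b) ≡ ι 12 * ∑[ a < n ] (w a * r a b) - ι 2 * (ι n - n ⁻¹) * sum w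
    𝓔-G w b = begin
      𝓔 w (λ a → G a b)
        ≡⟨ 𝓔-by-parts w (λ a → G a b) ⟩
      ∑[ c < n ] (w (next c) * ((G (next c) b - G c b) - (G (next (next c)) b - G (next c) b)))
        ≡⟨ sum-cong-≗ (λ c → cong (w (next c) *_)
             (biharmonic-algebra (ι n) (n ⁻¹) (r c b) (D c b) (D (next c) b) (𝟙 (next c Fin.≟ b)) (r-next c b) (r-next (next c) b) (D² c b) (D² (next c) b) (D-next c b) (*-inverse n) (𝟙*r (next c)))) ⟩
      ∑[ c < n ] (w (next c) * (ι 12 * r (next c) b - ι 2 * (ι n - n ⁻¹)))
        ≡⟨ ∑-next (λ a → w a * (ι 12 * r a b - ι 2 * (ι n - n ⁻¹))) ⟩
      ∑[ a < n ] (w a * (ι 12 * r a b - ι 2 * (ι n - n ⁻¹)))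
        ≡⟨ sum-cong-≗ (λ a → solve 3 (λ w r k → w :* (con (ι 12) :* r :- k) := con (ι 12) :* (w :* r) :+ (:- k) :* w)
             refl (w a) (r a b) (ι 2 * (ι n - n ⁻¹))) ⟩
      ∑[ a < n ] (ι 12 * (w a * r a b) + (- (ι 2 * (ι n - n ⁻¹))) * w a)
        ≡⟨ ∑-lin (ι 12) (- (ι 2 * (ι n - n ⁻¹))) _ w ⟩
      ι 12 * ∑[ a < n ] (w a * r a b) + (- (ι 2 * (ι n - n ⁻¹))) * sum w
        ≡⟨ solve 3 (λ x k s → x :+ (:- k) :* s := x :- k :* s) refl (ι 12 * ∑[ a < n ] (w a * r a b)) (ι 2 * (ι n - n ⁻¹)) (sum w) ⟩
      ι 12 * ∑[ a < n ] (w a * r a b) - ι 2 * (ι n - n ⁻¹) * sum w ∎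
      where
      𝟙*r : ∀ a → 𝟙 (a Fin.≟ b) * r a b ≡ 0ℚ
      𝟙*r a with a Fin.≟ b
      ... | yes refl = trans (ℚ.*-identityˡ (r a a)) (r-diag a)
      ... | no  _    = ℚ.*-zeroˡ (r a b)

    -- Paired with a constant function `𝓔` vanishes, so `𝓔-G` at the constant 1 is a linear equation
    -- for the sum.
    ∑-r : ∀ b → ∑[ a < n ] r a b ≡ + 1 / 6 * (ι n * ι n - 1ℚ)
    ∑-r b = begin
      S
        ≡⟨ solve 2 (λ S k → S := con (+ 1 / 12) :* (con (ι 12) :* S :- k :+ k)) refl S K ⟩
      + 1 / 12 * (ι 12 * S - K + K)
        ≡⟨ cong (λ z → + 1 / 12 * (z + K)) balance ⟩
      + 1 / 12 * (0ℚ + ι 2 * (ι n - n ⁻¹) * (ι n * 1ℚ))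
        ≡⟨ modulo (- (+ 1 / 6)) (*-inverse n) (solve 2 (λ m v →
             con (+ 1 / 12) :* (con 0ℚ :+ con (ι 2) :* (m :- v) :* (m :* con 1ℚ)) :=
             con (+ 1 / 6) :* (m :* m :- con 1ℚ) :+ con (- (+ 1 / 6)) :* (m :* v :- con 1ℚ)) refl (ι n) (n ⁻¹)) ⟩
      + 1 / 6 * (ι n * ι n - 1ℚ) ∎
      where
      S = ∑[ a < n ] r a b
      K = ι 2 * (ι n - n ⁻¹) * (ι n * 1ℚ)
      balance : ι 12 * S - K ≡ 0ℚ
      balance = begin
        ι 12 * S - K
          ≡⟨ cong₂ (λ x y → ι 12 * x - ι 2 * (ι n - n ⁻¹) * y)
               (sum-cong-≗ (λ a → sym (ℚ.*-identityˡ (r a b)))) (sym (∑-const n 1ℚ)) ⟩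
        ι 12 * ∑[ a < n ] (1ℚ * r a b) - ι 2 * (ι n - n ⁻¹) * ∑[ a < n ] 1ℚ
          ≡⟨ sym (𝓔-G (λ _ → 1ℚ) b) ⟩
        𝓔 (λ _ → 1ℚ) (λ a → G a b)
          ≡⟨ 𝓔-constˡ 1ℚ (λ a → G a b) ⟩
        0ℚ ∎

    -- Reciprocity. The constants of `𝓔-G` cancel in the difference, so the sum is `𝓔 ψ χ` divided
    -- by 12. By symmetry of `𝓔` the Laplacian may act on `ψ` instead, whose sources sit only at `x`
    -- and `y`; hence `χ` is merely evaluated there, and `χ y - χ x` is `2 * G x y`.
    ∑-r-diff² : ∀ x y → ∑[ a < n ] ((r a x - r a y) * (r a x - r a y)) ≡ + 1 / 3 * G x y
    ∑-r-diff² x y = begin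
      ∑[ a < n ] (ψ a * ψ a)
        ≡⟨ trans (sum-cong-≗ λ a → solve 3 (λ p r s → p :* (r :- s) := con 1ℚ :* (p :* r) :+ con (- 1ℚ) :* (p :* s)) refl (ψ a) (r a x) (r a y))
             (∑-lin 1ℚ (- 1ℚ) (λ a → ψ a * r a x) (λ a → ψ a * r a y)) ⟩
      1ℚ * A + (- 1ℚ) * B
        ≡⟨ solve 3 (λ a b k → con 1ℚ :* a :+ con (- 1ℚ) :* b :=
             con (+ 1 / 12) :* (con 1ℚ :* (con (ι 12) :* a :- k) :+ con (- 1ℚ) :* (con (ι 12) :* b :- k))) refl A B K ⟩
      + 1 / 12 * (1ℚ * (ι 12 * A - K) + (- 1ℚ) * (ι 12 * B - K))
        ≡⟨ cong₂ (λ u v → + 1 / 12 * (1ℚ * u + (- 1ℚ) * v)) (sym (𝓔-G ψ x)) (sym (𝓔-G ψ y)) ⟩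
      + 1 / 12 * (1ℚ * 𝓔 ψ (λ a → G a x) + (- 1ℚ) * 𝓔 ψ (λ a → G a y))
        ≡⟨ cong (+ 1 / 12 *_) (sym (𝓔-lin ψ 1ℚ (- 1ℚ) 0ℚ (λ a → G a x) (λ a → G a y))) ⟩
      + 1 / 12 * 𝓔 ψ χ
        ≡⟨ cong (+ 1 / 12 *_) (trans (𝓔-sym ψ χ) (𝓔-congʳ χ λ a →
             solve 2 (λ r s → r :- s := con 1ℚ :* r :+ con (- 1ℚ) :* s :+ con 0ℚ) refl (r a x) (r a y))) ⟩
      + 1 / 12 * 𝓔 χ (λ a → 1ℚ * r a x + (- 1ℚ) * r a y + 0ℚ)
        ≡⟨ cong (+ 1 / 12 *_) (𝓔-lin χ 1ℚ (- 1ℚ) 0ℚ (λ a → r a x) (λ a → r a y)) ⟩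
      + 1 / 12 * (1ℚ * 𝓔 χ (λ a → r a x) + (- 1ℚ) * 𝓔 χ (λ a → r a y))
        ≡⟨ cong₂ (λ u v → + 1 / 12 * (1ℚ * u + (- 1ℚ) * v)) (𝓔-r χ x) (𝓔-r χ y) ⟩
      + 1 / 12 * (1ℚ * (ι 2 * (n ⁻¹ * sum χ - χ x)) + (- 1ℚ) * (ι 2 * (n ⁻¹ * sum χ - χ y)))
        ≡⟨ cong₂ (λ u v → + 1 / 12 * (1ℚ * (ι 2 * (n ⁻¹ * sum χ - u)) + (- 1ℚ) * (ι 2 * (n ⁻¹ * sum χ - v)))) χx χy ⟩
      + 1 / 12 * (1ℚ * (ι 2 * (n ⁻¹ * sum χ - (- G x y))) + (- 1ℚ) * (ι 2 * (n ⁻¹ * sum χ - G x y)))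
        ≡⟨ solve 2 (λ k g → con (+ 1 / 12) :* (con 1ℚ :* (con (ι 2) :* (k :- (:- g))) :+ con (- 1ℚ) :* (con (ι 2) :* (k :- g)))
             := con (+ 1 / 3) :* g) refl (n ⁻¹ * sum χ) (G x y) ⟩
      + 1 / 3 * G x y ∎
      where
      ψ χ : Vector ℚ n
      ψ a = r a x - r a y
      χ a = 1ℚ * G a x + (- 1ℚ) * G a y + 0ℚ
      A = ∑[ a < n ] (ψ a * r a x)
      B = ∑[ a < n ] (ψ a * r a y)
      K = ι 2 * (ι n - n ⁻¹) * sum ψ
      G-diag : ∀ a → G a a ≡ 0ℚ
      G-diag a = trans (cong (λ z → ι n * (z * z) + ι 2 * z) (r-diag a))
        (solve 1 (λ m → m :* (con 0ℚ :* con 0ℚ) :+ con (ι 2) :* con 0ℚ := con 0ℚ) refl (ι n))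
      χx : χ x ≡ - G x y
      χx = trans (cong (λ z → 1ℚ * z + (- 1ℚ) * G x y + 0ℚ) (G-diag x))
        (solve 1 (λ g → con 1ℚ :* con 0ℚ :+ con (- 1ℚ) :* g :+ con 0ℚ := :- g) refl (G x y))
      χy : χ y ≡ G x y
      χy = trans (cong₂ (λ u z → 1ℚ * (ι n * (u * u) + ι 2 * u) + (- 1ℚ) * z + 0ℚ) (r-sym y x) (G-diag y))
        (solve 1 (λ g → con 1ℚ :* g :+ con (- 1ℚ) :* con 0ℚ :+ con 0ℚ := g) refl (G x y))

  -- Resistances from potentials

  ∑-swapʳ : ∀ {k l} (X : Fin k → Vector ℚ l) (h : Vector ℚ l) →
            ∑[ v < l ] ((∑[ i < k ] X i v) * h v) ≡ ∑[ i < k ] ∑[ v < l ] (X i v * h v)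
  ∑-swapʳ X h = trans (sum-cong-≗ λ v → *-distribʳ-sum (h v) (λ i → X i v)) (∑-comm λ v i → X i v * h v)

  module _ {N : ℕ} (G : Graph N) where
    open Graph G

    laplacian-action : ∀ f u → (laplacian G *ᵥ f) u ≡ ∑[ v < N ] (adjacency G u v * (f u - f v))
    laplacian-action f u = begin
      ∑[ v < N ] ((𝟙 (u Fin.≟ v) * degree G u - A v) * f v)
        ≡⟨ sum-cong-≗ (λ v → solve 4 (λ e d a f → (e :* d :- a) :* f := e :* (d :* f) :- a :* f) refl
             (𝟙 (u Fin.≟ v)) (degree G u) (A v) (f v)) ⟩
      ∑[ v < N ] (𝟙 (u Fin.≟ v) * (degree G u * f v) - A v * f v)
        ≡⟨ ∑-distrib-- (λ v → 𝟙 (u Fin.≟ v) * (degree G u * f v)) (λ v → A v * f v) ⟩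
      ∑[ v < N ] (𝟙 (u Fin.≟ v) * (degree G u * f v)) - ∑[ v < N ] (A v * f v)
        ≡⟨ cong (_- (∑[ v < N ] (A v * f v))) (trans (∑-𝟙 u (λ v → degree G u * f v)) (*-distribʳ-sum (f u) A)) ⟩
      ∑[ v < N ] (A v * f u) - ∑[ v < N ] (A v * f v)
        ≡⟨ sym (∑-distrib-- (λ v → A v * f u) (λ v → A v * f v)) ⟩
      ∑[ v < N ] (A v * f u - A v * f v)
        ≡⟨ sum-cong-≗ (λ v → solve 3 (λ a f g → a :* f :- a :* g := a :* (f :- g)) refl (A v) (f u) (f v)) ⟩
      ∑[ v < N ] (A v * (f u - f v)) ∎
      where A = adjacency G u

    laplacian-symmetric : ∀ u v → laplacian G u v ≡ laplacian G v u
    laplacian-symmetric u v = cong₂ _-_ diagonal (𝟙-cong (u adj? v) (v adj? u) sym-Adj sym-Adj)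
      where
      diagonal : 𝟙 (u Fin.≟ v) * degree G u ≡ 𝟙 (v Fin.≟ u) * degree G v
      diagonal with u Fin.≟ v
      ... | yes refl = cong (_* degree G u) (sym (𝟙-yes (u Fin.≟ u) refl))
      ... | no  u≢v  = trans (ℚ.*-zeroˡ (degree G u)) (sym (trans
        (cong (_* degree G v) (𝟙-no (v Fin.≟ u) (u≢v ∘ sym))) (ℚ.*-zeroˡ (degree G v))))

    laplacian-selfAdjoint : ∀ f g → (laplacian G *ᵥ f) · g ≡ f · (laplacian G *ᵥ g)
    laplacian-selfAdjoint f g = trans
      (·-cong (λ j → trans (·-comm (laplacian G j) f) (·-cong {u = f} (λ _ → refl) (laplacian-symmetric j))) (λ _ → refl))
      (·-assoc f (laplacian G) g)

    -- If L h = e, then eᵀ L† e = hᵀ L L† L h = hᵀ e.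
    potential-energy : ∀ h e → (∀ k → (laplacian G *ᵥ h) k ≡ e k) → e · (laplacian G † *ᵥ e) ≡ h · e
    potential-energy h e Lh≗e = begin
      e · (M *ᵥ e)         ≡⟨ ·-cong (λ k → sym (Lh≗e k)) (λ _ → refl) ⟩
      (L *ᵥ h) · (M *ᵥ e)  ≡⟨ laplacian-selfAdjoint h (M *ᵥ e) ⟩
      h · (L *ᵥ (M *ᵥ e))  ≡⟨ ·-cong {u = h} (λ _ → refl) LMe≗e ⟩
      h · e                ∎
      where
      L M : Matrix N N
      L = laplacian G
      M = L †
      LMe≗e : ∀ k → (L *ᵥ (M *ᵥ e)) k ≡ e k
      LMe≗e k = begin
        L k · (M *ᵥ e)         ≡⟨ sym (·-assoc (L k) M e) ⟩
        (L ⊗ M) k · e          ≡⟨ ·-cong {u = (L ⊗ M) k} (λ _ → refl) (λ j → sym (Lh≗e j)) ⟩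
        (L ⊗ M) k · (L *ᵥ h)   ≡⟨ sym (·-assoc ((L ⊗ M) k) L h) ⟩
        ((L ⊗ M) ⊗ L) k · h    ≡⟨ ·-cong (IsMoorePenroseInverse.AXA≗A (†-isMoorePenroseInverse L) k) (λ _ → refl) ⟩
        L k · h                ≡⟨ Lh≗e k ⟩
        e k                    ∎

    module _ (R : Matrix N N) (τ : Vector ℚ N) (R-diag : ∀ v → R v v ≡ 0ℚ)
             (LR : ∀ u v → (laplacian G *ᵥ (λ w → R w v)) u ≡ τ u - ι 2 * 𝟙 (v Fin.≟ u)) where

      -- `LR` controls `R` in its first argument, and `τ` cancels in the difference of two columns.
      -- As `R` is not assumed symmetric, the mean of two opposite entries appears; a sum over
      -- ordered pairs does not see the distinction.
      resistance-symmetrised : ∀ i j → resistance G i j ≡ ½ * R i j + ½ * R j i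
      resistance-symmetrised i j = begin
        resistance G i j
          ≡⟨ potential-energy h e Lh≗e ⟩
        ∑[ k < N ] (h k * (𝟙 (i Fin.≟ k) - 𝟙 (j Fin.≟ k)))
          ≡⟨ trans (sum-cong-≗ λ k → solve 3 (λ h p q → h :* (p :- q) := p :* h :- q :* h) refl (h k) (𝟙 (i Fin.≟ k)) (𝟙 (j Fin.≟ k)))
               (∑-distrib-- (λ k → 𝟙 (i Fin.≟ k) * h k) (λ k → 𝟙 (j Fin.≟ k) * h k)) ⟩
        ∑[ k < N ] (𝟙 (i Fin.≟ k) * h k) - ∑[ k < N ] (𝟙 (j Fin.≟ k) * h k)
          ≡⟨ cong₂ _-_ (∑-𝟙 i h) (∑-𝟙 j h) ⟩
        h i - h j
          ≡⟨ cong₂ (λ p q → ((- ½) * p + ½ * R i j) - ((- ½) * R j i + ½ * q)) (R-diag i) (R-diag j) ⟩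
        ((- ½) * 0ℚ + ½ * R i j) - ((- ½) * R j i + ½ * 0ℚ)
          ≡⟨ solve 2 (λ p q → (con (- ½) :* con 0ℚ :+ con ½ :* p) :- (con (- ½) :* q :+ con ½ :* con 0ℚ)
               := con ½ :* p :+ con ½ :* q) refl (R i j) (R j i) ⟩
        ½ * R i j + ½ * R j i ∎
        where
        h e : Vector ℚ N
        h u = (- ½) * R u i + ½ * R u j
        e k = 𝟙 (i Fin.≟ k) - 𝟙 (j Fin.≟ k)
        Lh≗e : ∀ k → (laplacian G *ᵥ h) k ≡ e k
        Lh≗e k = begin
          (laplacian G *ᵥ h) k
            ≡⟨ trans (sum-cong-≗ λ u → solve 3 (λ l p q → l :* (con (- ½) :* p :+ con ½ :* q) :=
                 con (- ½) :* (l :* p) :+ con ½ :* (l :* q)) refl (laplacian G k u) (R u i) (R u j))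
               (∑-lin (- ½) ½ (λ u → laplacian G k u * R u i) (λ u → laplacian G k u * R u j)) ⟩
          (- ½) * (laplacian G *ᵥ (λ u → R u i)) k + ½ * (laplacian G *ᵥ (λ u → R u j)) k
            ≡⟨ cong₂ (λ p q → (- ½) * p + ½ * q) (LR k i) (LR k j) ⟩
          (- ½) * (τ k - ι 2 * 𝟙 (i Fin.≟ k)) + ½ * (τ k - ι 2 * 𝟙 (j Fin.≟ k))
            ≡⟨ solve 3 (λ t p q → con (- ½) :* (t :- con (ι 2) :* p) :+ con ½ :* (t :- con (ι 2) :* q) := p :- q)
                 refl (τ k) (𝟙 (i Fin.≟ k)) (𝟙 (j Fin.≟ k)) ⟩
          e k ∎

      Kf≡½∑∑ : Kf G ≡ ½ * (∑[ u < N ] ∑[ v < N ] R u v)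
      Kf≡½∑∑ = cong (½ *_) (begin
        ∑[ u < N ] ∑[ v < N ] resistance G u v
          ≡⟨ sum-cong-≗ (λ u → trans (sum-cong-≗ (resistance-symmetrised u)) (∑-lin ½ ½ (R u) (λ v → R v u))) ⟩
        ∑[ u < N ] (½ * (∑[ v < N ] R u v) + ½ * (∑[ v < N ] R v u))
          ≡⟨ ∑-lin ½ ½ (λ u → ∑[ v < N ] R u v) (λ u → ∑[ v < N ] R v u) ⟩
        ½ * S + ½ * (∑[ u < N ] ∑[ v < N ] R v u)
          ≡⟨ cong (λ z → ½ * S + ½ * z) (∑-comm (λ u v → R v u)) ⟩
        ½ * S + ½ * S
          ≡⟨ solve 1 (λ s → con ½ :* s :+ con ½ :* s := s) refl S ⟩
        S ∎)
        where
        S = ∑[ u < N ] ∑[ v < N ] R u v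

  -- Adjacency in the sunflower

  next-injective : ∀ {n} {i j : Fin n} → next i ≡ next j → i ≡ j
  next-injective {i = i} {j} eq with nextView i | nextView j
  ... | step _ p | step _ q = Fin.toℕ-injective (ℕ.suc-injective (trans (sym p) (trans (cong toℕ eq) q)))
  ... | wrap p _ | wrap q _ = Fin.toℕ-injective (ℕ.suc-injective (trans p (sym q)))
  ... | step _ p | wrap _ q = contradiction (trans (sym p) (trans (cong toℕ eq) q)) λ ()
  ... | wrap _ p | step _ q = contradiction (trans (sym q) (trans (cong toℕ (sym eq)) p)) λ ()

  -- Returning after two steps means wrapping once, which forces `n = 2`, or twice, which forces
  -- `n = 1`.
  next²≢ : ∀ {n} → 3 ℕ.≤ n → (i : Fin n) → next (next i) ≢ i
  next²≢ {n} 3≤n i eq with nextView i | nextView (next i)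
  ... | step _ p | step _ q = ℕ.m+1+n≢m (toℕ i) (begin
      toℕ i ℕ.+ 2            ≡⟨ ℕ.+-comm (toℕ i) 2 ⟩
      suc (suc (toℕ i))      ≡⟨ cong suc (sym p) ⟩
      suc (toℕ (next i))     ≡⟨ sym q ⟩
      toℕ (next (next i))    ≡⟨ cong toℕ eq ⟩
      toℕ i                  ∎)
  ... | step _ p | wrap q r = contradiction (subst (3 ℕ.≤_) n≡2 3≤n) λ { (ℕ.s≤s (ℕ.s≤s ())) }
    where
    n≡2 : n ≡ 2
    n≡2 = trans (sym q) (cong suc (trans p (cong suc (trans (cong toℕ (sym eq)) r))))
  ... | wrap p q | step _ r = contradiction (subst (3 ℕ.≤_) n≡2 3≤n) λ { (ℕ.s≤s (ℕ.s≤s ())) }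
    where
    n≡2 : n ≡ 2
    n≡2 = trans (sym p) (cong suc (trans (cong toℕ (sym eq)) (trans r (cong suc q))))
  ... | wrap p q | wrap r _ = contradiction (subst (3 ℕ.≤_) (trans (sym r) (cong suc q)) 3≤n) λ { (ℕ.s≤s ()) }

  -- For `m ≥ 3` the two alternatives of adjacency exclude each other, so their indicators add up,
  -- and every edge is met once from each end.
  ∑∑-cycle : ∀ m (3≤m : 3 ℕ.≤ m) (g : Fin m → Fin m → ℚ) →
    ∑[ a < m ] ∑[ b < m ] (adjacency (cycle m 3≤m) a b * g a b) ≡ ∑[ c < m ] (g c (next c) + g (next c) c)
  ∑∑-cycle m 3≤m g = begin
    ∑[ a < m ] ∑[ b < m ] (adjacency (cycle m 3≤m) a b * g a b)
      ≡⟨ sum-cong-≗ (λ a → trans (sum-cong-≗ λ b → trans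
           (cong (_* g a b) (𝟙-⊎ (next a Fin.≟ b) (next b Fin.≟ a) λ { (refl , q) → next²≢ 3≤m a q }))
           (ℚ.*-distribʳ-+ (g a b) (𝟙 (next a Fin.≟ b)) (𝟙 (next b Fin.≟ a))))
           (∑-distrib-+ (λ b → 𝟙 (next a Fin.≟ b) * g a b) (λ b → 𝟙 (next b Fin.≟ a) * g a b))) ⟩
    ∑[ a < m ] (∑[ b < m ] (𝟙 (next a Fin.≟ b) * g a b) + ∑[ b < m ] (𝟙 (next b Fin.≟ a) * g a b))
      ≡⟨ ∑-distrib-+ (λ a → ∑[ b < m ] (𝟙 (next a Fin.≟ b) * g a b)) (λ a → ∑[ b < m ] (𝟙 (next b Fin.≟ a) * g a b)) ⟩
    ∑[ a < m ] ∑[ b < m ] (𝟙 (next a Fin.≟ b) * g a b) + ∑[ a < m ] ∑[ b < m ] (𝟙 (next b Fin.≟ a) * g a b)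
      ≡⟨ cong₂ _+_ (sum-cong-≗ λ a → ∑-𝟙 (next a) (g a))
           (trans (∑-comm (λ a b → 𝟙 (next b Fin.≟ a) * g a b)) (sum-cong-≗ λ b → ∑-𝟙 (next b) (λ a → g a b))) ⟩
    ∑[ c < m ] g c (next c) + ∑[ c < m ] g (next c) c
      ≡⟨ sym (∑-distrib-+ (λ c → g c (next c)) (λ c → g (next c) c)) ⟩
    ∑[ c < m ] (g c (next c) + g (next c) c) ∎

  module Sunflower (m n : ℕ) (3≤m : 3 ℕ.≤ m) (3≤n : 3 ℕ.≤ n) (x y : Fin m) (x≢y : x ≢ y) where
    open Gluing {m} {n} x y x≢y public

    F : Graph (n ℕ.* ℕ.pred m)
    F = sunflower m n 3≤m 3≤n x y x≢y

    C : Graph m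
    C = cycle m 3≤m

    open Graph C using (Adj; _adj?_; irrefl)

    glue-y : ∀ i → glue (i , y) ≡ glue (next i , x)
    glue-y i with y Fin.≟ y
    ... | yes _   = sym (glue-vertex (≢-sym x≢y))
    ... | no  y≢y = contradiction refl y≢y

    -- The fibres of `glue`. A single identification suffices: as `x ≢ y` and `next` is injective,
    -- no terminal takes part in two of them, so no longer chains arise.
    data Glued (i : Fin n) (a : Fin m) (j : Fin n) (b : Fin m) : Set where
      same : i ≡ j → a ≡ b → Glued i a j b
      yx   : a ≡ y → b ≡ x → j ≡ next i → Glued i a j b
      xy   : a ≡ x → b ≡ y → i ≡ next j → Glued i a j b

    glued : ∀ i a j b → glue (i , a) ≡ glue (j , b) → Glued i a j b
    glued i a j b eq with y Fin.≟ a | y Fin.≟ b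
    ... | yes refl | yes refl = same (next-injective (cong proj₁ (vertex-injective (≢-sym x≢y) (≢-sym x≢y) eq))) refl
    ... | yes refl | no y≢b   = yx refl (cong proj₂ (sym inj)) (cong proj₁ (sym inj))
      where inj = vertex-injective (≢-sym x≢y) y≢b eq
    ... | no y≢a   | yes refl = xy (cong proj₂ inj) refl (cong proj₁ inj)
      where inj = vertex-injective y≢a (≢-sym x≢y) eq
    ... | no y≢a   | no y≢b   = same (cong proj₁ inj) (cong proj₂ inj)
      where inj = vertex-injective y≢a y≢b eq

    -- Two distinct copies share at most one vertex once `n ≥ 3`, so they cannot share both ends of
    -- an edge. In a ring of two copies they would share both terminals, which is the case that
    -- `next²≢` refutes.
    edge-copy : ∀ {i a b j c d} → a ≢ b → glue (i , a) ≡ glue (j , c) → glue (i , b) ≡ glue (j , d) → i ≡ j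
    edge-copy {i} {a} {b} {j} {c} {d} a≢b p q with glued i a j c p | glued i b j d q
    ... | same i≡j _   | _            = i≡j
    ... | _            | same i≡j _   = i≡j
    ... | yx refl _ _  | yx refl _ _  = contradiction refl a≢b
    ... | xy refl _ _  | xy refl _ _  = contradiction refl a≢b
    ... | yx _ _ refl  | xy _ _ i≡    = contradiction (sym i≡) (next²≢ 3≤n i)
    ... | xy _ _ i≡    | yx _ _ refl  = contradiction (sym i≡) (next²≢ 3≤n i)

    -- An edge determines its copy by `edge-copy`, and then both ends within the copy since `glue`
    -- is injective there. Each of the three nested existentials thus has at most one witness.
    adjacency-F : ∀ u v → adjacency F u v ≡
      ∑[ i < n ] ∑[ a < m ] ∑[ b < m ] (adjacency C a b * (𝟙 (glue (i , a) Fin.≟ u) * 𝟙 (glue (i , b) Fin.≟ v)))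
    adjacency-F u v =
      trans (𝟙-any copy? λ { (a , b , ab , p , q) (c , d , _ , p′ , q′) →
        edge-copy (λ a≡b → irrefl a≡b ab) (trans p (sym p′)) (trans q (sym q′)) }) (sum-cong-≗ λ i →
      trans (𝟙-any (tail? i) λ { (_ , _ , p , _) (_ , _ , p′ , _) → glue-injective-copy (2≤ 3≤n) i (trans p (sym p′)) }) (sum-cong-≗ λ a →
      trans (𝟙-any (head? i a) λ { (_ , _ , q) (_ , _ , q′) → glue-injective-copy (2≤ 3≤n) i (trans q (sym q′)) }) (sum-cong-≗ λ b →
      trans (𝟙-× (a adj? b) ((glue (i , a) Fin.≟ u) ×-dec (glue (i , b) Fin.≟ v)))
        (cong (adjacency C a b *_) (𝟙-× (glue (i , a) Fin.≟ u) (glue (i , b) Fin.≟ v))))))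
      where
      head? : ∀ i a → Decidable λ b → Adj a b × glue (i , a) ≡ u × glue (i , b) ≡ v
      head? i a b = (a adj? b) ×-dec (glue (i , a) Fin.≟ u) ×-dec (glue (i , b) Fin.≟ v)
      tail? : ∀ i → Decidable λ a → ∃ λ b → Adj a b × glue (i , a) ≡ u × glue (i , b) ≡ v
      tail? i a = Fin.any? (head? i a)
      copy? : Decidable λ i → ∃ λ a → ∃ λ b → Adj a b × glue (i , a) ≡ u × glue (i , b) ≡ v
      copy? i = Fin.any? (tail? i)

    -- Terminals and inner vertices are treated alike: at a glued vertex the pulled-back indicator
    -- simply takes the value 1 in two copies.
    laplacian-F : ∀ f u → (laplacian F *ᵥ f) u ≡
      ∑[ i < n ] 𝓔 (λ a → 𝟙 (glue (i , a) Fin.≟ u)) (λ a → f (glue (i , a)))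
    laplacian-F f u = begin
      (laplacian F *ᵥ f) u
        ≡⟨ laplacian-action F f u ⟩
      ∑[ v < N ] (adjacency F u v * h v)
        ≡⟨ sum-cong-≗ (λ v → cong (_* h v) (adjacency-F u v)) ⟩
      ∑[ v < N ] ((∑[ i < n ] ∑[ a < m ] ∑[ b < m ] term i a b v) * h v)
        ≡⟨ ∑-swapʳ (λ i v → ∑[ a < m ] ∑[ b < m ] term i a b v) h ⟩
      ∑[ i < n ] ∑[ v < N ] ((∑[ a < m ] ∑[ b < m ] term i a b v) * h v)
        ≡⟨ sum-cong-≗ (λ i → trans (∑-swapʳ (λ a v → ∑[ b < m ] term i a b v) h) (sum-cong-≗ λ a →
             trans (∑-swapʳ (λ b v → term i a b v) h) (sum-cong-≗ λ b → edge-term i a b))) ⟩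
      ∑[ i < n ] ∑[ a < m ] ∑[ b < m ] (adjacency C a b * (w i a * (f (glue (i , a)) - f (glue (i , b)))))
        ≡⟨ sum-cong-≗ (λ i → trans (∑∑-cycle m 3≤m (λ a b → w i a * (f (glue (i , a)) - f (glue (i , b)))))
             (sum-cong-≗ λ c → solve 4 (λ w w′ g g′ → w :* (g :- g′) :+ w′ :* (g′ :- g) := (w′ :- w) :* (g′ :- g)) refl
               (w i c) (w i (next c)) (f (glue (i , c))) (f (glue (i , next c))))) ⟩
      ∑[ i < n ] 𝓔 (w i) (λ a → f (glue (i , a))) ∎
      where
      N = n ℕ.* ℕ.pred m
      h : Vector ℚ N
      h v = f u - f v
      w : Fin n → Vector ℚ m
      w i a = 𝟙 (glue (i , a) Fin.≟ u)
      term : Fin n → Fin m → Fin m → Vector ℚ N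
      term i a b v = adjacency C a b * (w i a * 𝟙 (glue (i , b) Fin.≟ v))
      -- On the support of the indicator `f u` is the value of `f` at the end of the edge. With
      -- that, the two orientations of an edge add up to a product of differences, a term of `𝓔`.
      localise : ∀ s z → 𝟙 (s Fin.≟ u) * (f u - z) ≡ 𝟙 (s Fin.≟ u) * (f s - z)
      localise s z with s Fin.≟ u
      ... | yes refl = refl
      ... | no  _    = trans (ℚ.*-zeroˡ (f u - z)) (sym (ℚ.*-zeroˡ (f s - z)))
      edge-term : ∀ i a b → ∑[ v < N ] (term i a b v * h v) ≡ adjacency C a b * (w i a * (f (glue (i , a)) - f (glue (i , b))))
      edge-term i a b = begin
        ∑[ v < N ] (term i a b v * h v)
          ≡⟨ trans (sum-cong-≗ λ v → solve 4 (λ p q r h → p :* (q :* r) :* h := p :* q :* (r :* h)) refl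
               (adjacency C a b) (w i a) (𝟙 (glue (i , b) Fin.≟ v)) (h v))
             (sym (*-distribˡ-sum (adjacency C a b * w i a) (λ v → 𝟙 (glue (i , b) Fin.≟ v) * h v))) ⟩
        adjacency C a b * w i a * ∑[ v < N ] (𝟙 (glue (i , b) Fin.≟ v) * h v)
          ≡⟨ cong (adjacency C a b * w i a *_) (∑-𝟙 (glue (i , b)) h) ⟩
        adjacency C a b * w i a * (f u - f (glue (i , b)))
          ≡⟨ trans (ℚ.*-assoc (adjacency C a b) (w i a) _) (cong (adjacency C a b *_) (localise (glue (i , a)) (f (glue (i , b))))) ⟩
        adjacency C a b * (w i a * (f (glue (i , a)) - f (glue (i , b)))) ∎

  -- Sums over the vertices

  ∑-split : ∀ k l (g : Vector ℚ (k ℕ.+ l)) → sum g ≡ ∑[ i < k ] g (i ↑ˡ l) + ∑[ j < l ] g (k ↑ʳ j)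
  ∑-split zero    l g = sym (ℚ.+-identityˡ (sum g))
  ∑-split (suc k) l g = trans (cong (_+_ (g zero)) (∑-split k l (g ∘ suc))) (sym (ℚ.+-assoc (g zero) _ _))

  ∑-combine : ∀ n k (g : Vector ℚ (n ℕ.* k)) → sum g ≡ ∑[ i < n ] ∑[ j < k ] g (combine i j)
  ∑-combine zero    k g = refl
  ∑-combine (suc n) k g = trans (∑-split k (n ℕ.* k) g)
    (cong (_+_ (∑[ j < k ] g (j ↑ˡ (n ℕ.* k)))) (∑-combine n k (g ∘ (k ↑ʳ_))))

  -- Omitting the position `y` leaves one representative of each vertex. The form total minus one
  -- value lets sums over the full cycle be inserted directly.
  ∑∖ : ∀ {m} → Fin m → Vector ℚ m → ℚ
  ∑∖ y h = sum h - h y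

  ∑∖-punchIn : ∀ {m} (y : Fin (suc m)) h → ∑∖ y h ≡ ∑[ k < m ] h (punchIn y k)
  ∑∖-punchIn y h = trans (cong (_- h y) (sum-remove {i = y} h))
    (solve 2 (λ a b → a :+ b :- a := b) refl (h y) (sum (λ k → h (punchIn y k))))

  ∑∖-cong : ∀ {m} (y : Fin m) {f g : Vector ℚ m} → (∀ a → f a ≡ g a) → ∑∖ y f ≡ ∑∖ y g
  ∑∖-cong y f≗g = cong₂ _-_ (sum-cong-≗ f≗g) (f≗g y)

  ∑∖-∑ : ∀ {m n} (y : Fin m) (f : Fin m → Vector ℚ n) →
         ∑∖ y (λ a → ∑[ j < n ] f a j) ≡ ∑[ j < n ] ∑∖ y (λ a → f a j)
  ∑∖-∑ {m} {n} y f = trans (cong (_- ∑[ j < n ] f y j) (∑-comm f)) (sym (∑-distrib-- (λ j → ∑[ a < m ] f a j) (f y)))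

  ∑∖-lin : ∀ {m} (y : Fin m) α β γ ε k (f g h e : Vector ℚ m) →
    ∑∖ y (λ a → α * f a + β * g a + (γ * h a + ε * e a) + k) ≡
    α * ∑∖ y f + β * ∑∖ y g + (γ * ∑∖ y h + ε * ∑∖ y e) + (ι m - 1ℚ) * k
  ∑∖-lin {m} y α β γ ε k f g h e = trans (cong (_- last) (begin
    ∑[ a < m ] (α * f a + β * g a + (γ * h a + ε * e a) + k)
      ≡⟨ ∑-distrib-+ (λ a → α * f a + β * g a + (γ * h a + ε * e a)) (λ _ → k) ⟩
    ∑[ a < m ] (α * f a + β * g a + (γ * h a + ε * e a)) + ∑[ a < m ] k
      ≡⟨ cong₂ _+_ (∑-distrib-+ (λ a → α * f a + β * g a) (λ a → γ * h a + ε * e a)) (∑-const m k) ⟩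
    ∑[ a < m ] (α * f a + β * g a) + ∑[ a < m ] (γ * h a + ε * e a) + ι m * k
      ≡⟨ cong₂ (λ u v → u + v + ι m * k) (∑-lin α β f g) (∑-lin γ ε h e) ⟩
    α * sum f + β * sum g + (γ * sum h + ε * sum e) + ι m * k ∎))
    (regroup (sum f) (sum g) (sum h) (sum e) (ι m))
    where
    last = α * f y + β * g y + (γ * h y + ε * e y) + k
    regroup : ∀ F G H E M → α * F + β * G + (γ * H + ε * E) + M * k - last ≡
      α * (F - f y) + β * (G - g y) + (γ * (H - h y) + ε * (E - e y)) + (M - 1ℚ) * k
    regroup F G H E M = solve 14 (λ α β γ ε k f g h e F G H E M →
      α :* F :+ β :* G :+ (γ :* H :+ ε :* E) :+ M :* k :- (α :* f :+ β :* g :+ (γ :* h :+ ε :* e) :+ k) :=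
      α :* (F :- f) :+ β :* (G :- g) :+ (γ :* (H :- h) :+ ε :* (E :- e)) :+ (M :- con 1ℚ) :* k)
      refl α β γ ε k (f y) (g y) (h y) (e y) F G H E M

  ∑-vertices : ∀ {m n} (y : Fin m) (g : Vector ℚ (n ℕ.* ℕ.pred m)) (h : Fin n → Vector ℚ m) →
    (∀ i a (p : y ≢ a) → g (vertex i a p) ≡ h i a) → sum g ≡ ∑[ i < n ] ∑∖ y (h i)
  ∑-vertices {suc m} {n} y g h g≡h = trans (∑-combine n m g) (sum-cong-≗ λ i → trans
    (sum-cong-≗ λ k → trans
      (cong (g ∘ combine i) (sym (trans (Fin.punchOut-cong y refl) (Fin.punchOut-punchIn y))))
      (g≡h i (punchIn y k) (λ p → Fin.punchInᵢ≢i y k (sym p))))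
    (sym (∑∖-punchIn y (h i))))


  -- `ν` stands for `1/n` and `s` for `1/ρ`. `A` is a row sum of `r`, while `Sσ`, `Sφ`, `SΦ` are the
  -- sums of `σ`, `φ`, `φ²` over the positions other than `y`. The distance `p` enters only through
  -- `ρ`.
  Kf-algebra : ∀ M N ρ ν s → N * ν ≡ 1ℚ → ρ * s ≡ 1ℚ →
    let A  = + 1 / 6 * (M * M - 1ℚ)
        Sσ = A - ½ * (M * ρ)
        Sφ = ½ * (M * ρ) - ρ
        SΦ = + 1 / 4 * (+ 1 / 3 * (M * (ρ * ρ) + ι 2 * ρ) + M * (ρ * ρ)) - ρ * ρ
        M′ = M - 1ℚ
    in ½ * (N * (M * A - A - A - ι 2 * M′ * Sσ
            + (N * (ι 2 * M′ * Sσ + ι 2 * (ν * s) * (Sφ * Sφ) - ι 2 * M′ * (ν * s) * SΦ)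
               + M′ * M′ * ρ * (+ 1 / 6 * (N * N - 1ℚ)))))
       ≡ + 1 / 12 * (N * ρ * (N * N * (M′ * M′) + M * M * (ι 4 - ι 6 * N) + ι 6 * M * N - 1ℚ))
         - + 1 / 12 * (N * (M * (M * M) + M - ι 2 - ι 2 * N * (M′ * M′) * (M + 1ℚ)))
  Kf-algebra M N ρ ν s Nν≡1 ρs≡1 =
    let Sφ = ½ * (M * ρ) - ρ
        SΦ = + 1 / 4 * (+ 1 / 3 * (M * (ρ * ρ) + ι 2 * ρ) + M * (ρ * ρ)) - ρ * ρ
        M′ = M - 1ℚ
        -- `ρ * W₁` equals `Sφ * Sφ - M′ * SΦ`, so `W₁` is what remains of that expression once `s`
        -- cancels one factor `ρ`.
        W₁ = (½ * M - 1ℚ) * (½ * M - 1ℚ) * ρ - M′ * (+ 1 / 3 * M * ρ + + 1 / 6 - ρ)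
    in modulo (N * s * (Sφ * Sφ - M′ * SΦ)) Nν≡1 (modulo (N * W₁) ρs≡1
    (solve 5 (λ M N ρ ν s →
      let A  = con (+ 1 / 6) :* (M :* M :- con 1ℚ)
          Sσ = A :- con ½ :* (M :* ρ)
          Sφ = con ½ :* (M :* ρ) :- ρ
          SΦ = con (+ 1 / 4) :* (con (+ 1 / 3) :* (M :* (ρ :* ρ) :+ con (ι 2) :* ρ) :+ M :* (ρ :* ρ)) :- ρ :* ρ
          M′ = M :- con 1ℚ
          W₁ = (con ½ :* M :- con 1ℚ) :* (con ½ :* M :- con 1ℚ) :* ρ :- M′ :* (con (+ 1 / 3) :* M :* ρ :+ con (+ 1 / 6) :- ρ)
      in con ½ :* (N :* (M :* A :- A :- A :- con (ι 2) :* M′ :* Sσ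
            :+ (N :* (con (ι 2) :* M′ :* Sσ :+ con (ι 2) :* (ν :* s) :* (Sφ :* Sφ) :- con (ι 2) :* M′ :* (ν :* s) :* SΦ)
               :+ M′ :* M′ :* ρ :* (con (+ 1 / 6) :* (N :* N :- con 1ℚ)))))
        := con (+ 1 / 12) :* (N :* ρ :* (N :* N :* (M′ :* M′) :+ M :* M :* (con (ι 4) :- con (ι 6) :* N) :+ con (ι 6) :* M :* N :- con 1ℚ))
         :- con (+ 1 / 12) :* (N :* (M :* (M :* M) :+ M :- con (ι 2) :- con (ι 2) :* N :* (M′ :* M′) :* (M :+ con 1ℚ)))
         :+ N :* s :* (Sφ :* Sφ :- M′ :* SΦ) :* (N :* ν :- con 1ℚ)
         :+ N :* W₁ :* (ρ :* s :- con 1ℚ))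
      refl M N ρ ν s))

  -- The resistance matrix of the sunflower

  -- On the left `δ` drops out, because there `r y b - σ b` equals `φ y - φ b`. The remaining
  -- mismatch is linear in the jump `D - D′` and in `t * ρ`, which the two hypotheses supply.
  Ψ-glue-algebra : ∀ {D D′ ν δ′ t ρ} δ f σ q → D - D′ ≡ ι 2 * (ν - δ′) → t * ρ ≡ ν →
    δ * (σ + ρ - f - 0ℚ - σ) + 0ℚ + σ + ρ * q + (D - δ + ν) * (ρ - f) - t * ((ρ - f) * (ρ - f)) ≡
    δ′ * (σ + f - 0ℚ - σ) + 0ℚ + σ + ρ * (q + D) + (D′ - δ′ + ν) * (0ℚ - f) - t * ((0ℚ - f) * (0ℚ - f))
  Ψ-glue-algebra {D} {D′} {ν} {δ′} {t} {ρ} δ f σ q h₁ h₂ =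
    modulo (- f) h₁ (modulo (- (ρ - ι 2 * f)) h₂
    (solve 10 (λ D D′ ν δ′ t ρ δ f σ q →
       δ :* (σ :+ ρ :- f :- con 0ℚ :- σ) :+ con 0ℚ :+ σ :+ ρ :* q :+ (D :- δ :+ ν) :* (ρ :- f) :- t :* ((ρ :- f) :* (ρ :- f)) :=
       δ′ :* (σ :+ f :- con 0ℚ :- σ) :+ con 0ℚ :+ σ :+ ρ :* (q :+ D) :+ (D′ :- δ′ :+ ν) :* (con 0ℚ :- f) :- t :* ((con 0ℚ :- f) :* (con 0ℚ :- f))
       :+ (:- f) :* (D :- D′ :- con (ι 2) :* (ν :- δ′)) :+ (:- (ρ :- con (ι 2) :* f)) :* (t :* ρ :- ν))
     refl D D′ ν δ′ t ρ δ f σ q))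

  module SunflowerPotential (m n : ℕ) (3≤m : 3 ℕ.≤ m) (3≤n : 3 ℕ.≤ n) (x y : Fin m) (x≢y : x ≢ y)
                            .{{_ : ℕ.NonZero m}} .{{_ : ℕ.NonZero n}}
                            (ρ⁻¹ : ℚ) (ρρ⁻¹≡1 : CycleResistance.r m x y * ρ⁻¹ ≡ 1ℚ) where
    open Sunflower m n 3≤m 3≤n x y x≢y
    open CycleResistance m using (r; r-sym; r-diag)
    open CycleForm m using (𝓔-r; ∑-r; ∑-r-diff²)
    open CycleResistance n using (D; D-next) renaming (r to q; r-diag to q-diag; r-next to q-next)

    ρ t : ℚ
    ρ = r x y
    t = n ⁻¹ * ρ⁻¹

    tρ≡n⁻¹ : t * ρ ≡ n ⁻¹
    tρ≡n⁻¹ = modulo (n ⁻¹) ρρ⁻¹≡1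
      (solve 3 (λ v s r → v :* s :* r := v :+ v :* (r :* s :- con 1ℚ)) refl (n ⁻¹) ρ⁻¹ ρ)

    -- φ is the voltage of a unit current from y to x, normalised by φ x = 0; σ vanishes at x and y.
    σ φ φ² : Vector ℚ m
    σ a = ½ * r a x + ½ * r a y + (- (½ * ρ))
    φ a = ½ * r a x + (- ½) * r a y + ½ * ρ
    φ² a = φ a * φ a

    σ-x : σ x ≡ 0ℚ
    σ-x = trans (cong (λ z → ½ * z + ½ * ρ + (- (½ * ρ))) (r-diag x))
      (solve 1 (λ ρ → con ½ :* con 0ℚ :+ con ½ :* ρ :+ (:- (con ½ :* ρ)) := con 0ℚ) refl ρ)

    σ-y : σ y ≡ 0ℚ
    σ-y = trans (cong₂ (λ u v → ½ * u + ½ * v + (- (½ * ρ))) (r-sym y x) (r-diag y))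
      (solve 1 (λ ρ → con ½ :* ρ :+ con ½ :* con 0ℚ :+ (:- (con ½ :* ρ)) := con 0ℚ) refl ρ)

    φ-x : φ x ≡ 0ℚ
    φ-x = trans (cong (λ z → ½ * z + (- ½) * ρ + ½ * ρ) (r-diag x))
      (solve 1 (λ ρ → con ½ :* con 0ℚ :+ con (- ½) :* ρ :+ con ½ :* ρ := con 0ℚ) refl ρ)

    φ-y : φ y ≡ ρ
    φ-y = trans (cong₂ (λ u v → ½ * u + (- ½) * v + ½ * ρ) (r-sym y x) (r-diag y))
      (solve 1 (λ ρ → con ½ :* ρ :+ con (- ½) :* con 0ℚ :+ con ½ :* ρ := ρ) refl ρ)

    -- Series law in the star with legs `σ b`, `φ b` and `ρ - φ b`; the companion `r-y` uses the
    -- third leg.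
    r-x : ∀ b → r x b ≡ σ b + φ b
    r-x b = trans (r-sym x b) (solve 3 (λ p q ρ → p :=
      con ½ :* p :+ con ½ :* q :+ (:- (con ½ :* ρ)) :+ (con ½ :* p :+ con (- ½) :* q :+ con ½ :* ρ)) refl (r b x) (r b y) ρ)

    r-y : ∀ b → r y b ≡ σ b + ρ - φ b
    r-y b = trans (r-sym y b) (solve 3 (λ p q ρ → q :=
      con ½ :* p :+ con ½ :* q :+ (:- (con ½ :* ρ)) :+ ρ :- (con ½ :* p :+ con (- ½) :* q :+ con ½ :* ρ)) refl (r b x) (r b y) ρ)

    -- κ is the mean of the forward and the backward difference of q (_, j) at i.
    δ κ : Fin n → Fin n → ℚ
    δ i j = 𝟙 (i Fin.≟ j)
    κ i j = D i j - δ i j + n ⁻¹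

    -- Cutting the ring of copies open at a vertex, Δh = (i - j) ρ + φ a - φ b is the voltage drop between two points,
    -- and closing it again changes a resistance by - Δh² / (n ρ).  Collecting the terms in i and j gives ρ q and κ.
    Ψ-form : ℚ → ℚ → ℚ → ℚ → ℚ → ℚ → ℚ → ℚ → ℚ
    Ψ-form δ κ q r σₐ σ φₐ φ = δ * (r - σₐ - σ) + σₐ + σ + ρ * q + κ * (φₐ - φ) - t * ((φₐ - φ) * (φₐ - φ))

    Ψ : Fin n → Fin m → Fin n → Fin m → ℚ
    Ψ i a j b = Ψ-form (δ i j) (κ i j) (q i j) (r a b) (σ a) (σ b) (φ a) (φ b)

    Ψ-diag : ∀ i a → Ψ i a i a ≡ 0ℚ
    Ψ-diag i a = begin
      Ψ i a i a
        ≡⟨ cong (λ e → Ψ-form e (κ i i) (q i i) (r a a) (σ a) (σ a) (φ a) (φ a)) (𝟙-yes (i Fin.≟ i) refl) ⟩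
      Ψ-form 1ℚ (κ i i) (q i i) (r a a) (σ a) (σ a) (φ a) (φ a)
        ≡⟨ cong₂ (λ p s → Ψ-form 1ℚ (κ i i) p s (σ a) (σ a) (φ a) (φ a)) (q-diag i) (r-diag a) ⟩
      Ψ-form 1ℚ (κ i i) 0ℚ 0ℚ (σ a) (σ a) (φ a) (φ a)
        ≡⟨ solve 5 (λ k s f ρ t → con 1ℚ :* (con 0ℚ :- s :- s) :+ s :+ s :+ ρ :* con 0ℚ :+ k :* (f :- f) :- t :* ((f :- f) :* (f :- f))
             := con 0ℚ) refl (κ i i) (σ a) (φ a) ρ t ⟩
      0ℚ ∎

    Ψ-glue : ∀ i j b → Ψ i y j b ≡ Ψ (next i) x j b
    Ψ-glue i j b = begin
      Ψ i y j b
        ≡⟨ cong (λ z → Ψ-form (δ i j) (κ i j) (q i j) z (σ y) (σ b) (φ y) (φ b)) (r-y b) ⟩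
      Ψ-form (δ i j) (κ i j) (q i j) (σ b + ρ - φ b) (σ y) (σ b) (φ y) (φ b)
        ≡⟨ cong₂ (λ u v → Ψ-form (δ i j) (κ i j) (q i j) (σ b + ρ - φ b) u (σ b) v (φ b)) σ-y φ-y ⟩
      Ψ-form (δ i j) (κ i j) (q i j) (σ b + ρ - φ b) 0ℚ (σ b) ρ (φ b)
        ≡⟨ Ψ-glue-algebra {t = t} (δ i j) (φ b) (σ b) (q i j) (D-next i j) tρ≡n⁻¹ ⟩
      Ψ-form (δ i′ j) (κ i′ j) (q i j + D i j) (σ b + φ b) 0ℚ (σ b) 0ℚ (φ b)
        ≡⟨ cong₂ (λ u v → Ψ-form (δ i′ j) (κ i′ j) (q i j + D i j) (σ b + φ b) u (σ b) v (φ b)) (sym σ-x) (sym φ-x) ⟩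
      Ψ-form (δ i′ j) (κ i′ j) (q i j + D i j) (σ b + φ b) (σ x) (σ b) (φ x) (φ b)
        ≡⟨ cong₂ (λ u v → Ψ-form (δ i′ j) (κ i′ j) u v (σ x) (σ b) (φ x) (φ b)) (sym (q-next i j)) (sym (r-x b)) ⟩
      Ψ i′ x j b ∎
      where i′ = next i

    module _ (w : Fin n → Vector ℚ m) where

      -- The part of 𝓔 (w i) (Ψ i _ j b) that survives summation over i and does not depend on (j , b).
      residual : Fin n → ℚ
      residual i = ι 2 * m ⁻¹ * sum (w i) - t * 𝓔 (w i) φ² - w i x - w i y + ι 2 * n ⁻¹ * w i y

      -- As a function of `a`, `Ψ` is a combination of `r a b`, `σ`, `φ`, `φ²` and a constant, and
      -- `𝓔-r` evaluates all of these but `φ²`, whose coefficient `- t` is free of `j` and `b`. The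
      -- term `2 n⁻¹ w i y` inside `residual` is taken off again here: it is reserved for the
      -- `2 n⁻¹` in `D-next`.
      𝓔-Ψ : ∀ i j b → 𝓔 (w i) (λ a → Ψ i a j b) ≡
        residual i - ι 2 * n ⁻¹ * w i y - ι 2 * (w i b * δ i j)
        + (D i j + n ⁻¹ + ι 2 * t * φ b) * w i y + (ι 2 * δ i j - D i j - n ⁻¹ - ι 2 * t * φ b) * w i x
      𝓔-Ψ i j b = begin
        𝓔 v (λ a → Ψ i a j b)
          ≡⟨ 𝓔-congʳ v (λ a → solve 9 (λ δ κ ρq t r σₐ σ φₐ f →
               δ :* (r :- σₐ :- σ) :+ σₐ :+ σ :+ ρq :+ κ :* (φₐ :- f) :- t :* ((φₐ :- f) :* (φₐ :- f)) :=
               con 1ℚ :* (δ :* r :+ (con 1ℚ :- δ) :* σₐ :+ con 0ℚ)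
               :+ con 1ℚ :* ((κ :+ con (ι 2) :* t :* f) :* φₐ :+ (:- t) :* (φₐ :* φₐ) :+ con 0ℚ)
               :+ ((con 1ℚ :- δ) :* σ :+ ρq :- κ :* f :- t :* (f :* f)))
               refl (δ i j) (κ i j) (ρ * q i j) t (r a b) (σ a) (σ b) (φ a) (φ b)) ⟩
        𝓔 v (λ a → 1ℚ * f₁ a + 1ℚ * f₂ a + k)
          ≡⟨ 𝓔-lin v 1ℚ 1ℚ k f₁ f₂ ⟩
        1ℚ * 𝓔 v f₁ + 1ℚ * 𝓔 v f₂
          ≡⟨ cong₂ (λ p q → 1ℚ * p + 1ℚ * q)
               (𝓔-lin v (δ i j) (1ℚ - δ i j) 0ℚ (λ a → r a b) σ) (𝓔-lin v (κ i j + ι 2 * t * φ b) (- t) 0ℚ φ φ²) ⟩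
        1ℚ * (δ i j * 𝓔 v (λ a → r a b) + (1ℚ - δ i j) * 𝓔 v σ) + 1ℚ * ((κ i j + ι 2 * t * φ b) * 𝓔 v φ + (- t) * 𝓔 v φ²)
          ≡⟨ cong₂ (λ p q → 1ℚ * (δ i j * 𝓔 v (λ a → r a b) + (1ℚ - δ i j) * p) + 1ℚ * ((κ i j + ι 2 * t * φ b) * q + (- t) * 𝓔 v φ²))
               (trans (𝓔-lin v ½ ½ (- (½ * ρ)) (λ a → r a x) (λ a → r a y)) (cong₂ (λ p q → ½ * p + ½ * q) (𝓔-r v x) (𝓔-r v y)))
               (trans (𝓔-lin v ½ (- ½) (½ * ρ) (λ a → r a x) (λ a → r a y)) (cong₂ (λ p q → ½ * p + (- ½) * q) (𝓔-r v x) (𝓔-r v y))) ⟩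
        1ℚ * (δ i j * 𝓔 v (λ a → r a b) + (1ℚ - δ i j) * (½ * (ι 2 * (S - v x)) + ½ * (ι 2 * (S - v y))))
          + 1ℚ * ((κ i j + ι 2 * t * φ b) * (½ * (ι 2 * (S - v x)) + (- ½) * (ι 2 * (S - v y))) + (- t) * 𝓔 v φ²)
          ≡⟨ cong (λ z → 1ℚ * (δ i j * z + (1ℚ - δ i j) * (½ * (ι 2 * (S - v x)) + ½ * (ι 2 * (S - v y))))
                + 1ℚ * ((κ i j + ι 2 * t * φ b) * (½ * (ι 2 * (S - v x)) + (- ½) * (ι 2 * (S - v y))) + (- t) * 𝓔 v φ²)) (𝓔-r v b) ⟩
        1ℚ * (δ i j * (ι 2 * (S - v b)) + (1ℚ - δ i j) * (½ * (ι 2 * (S - v x)) + ½ * (ι 2 * (S - v y))))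
          + 1ℚ * ((κ i j + ι 2 * t * φ b) * (½ * (ι 2 * (S - v x)) + (- ½) * (ι 2 * (S - v y))) + (- t) * 𝓔 v φ²)
          ≡⟨ solve 11 (λ δ D ν t f μ s vb vx vy Q →
               let two = con (ι 2); S = μ :* s in
               con 1ℚ :* (δ :* (two :* (S :- vb)) :+ (con 1ℚ :- δ) :* (con ½ :* (two :* (S :- vx)) :+ con ½ :* (two :* (S :- vy))))
               :+ con 1ℚ :* ((D :- δ :+ ν :+ two :* t :* f) :* (con ½ :* (two :* (S :- vx)) :+ con (- ½) :* (two :* (S :- vy))) :+ (:- t) :* Q)
               := two :* μ :* s :- t :* Q :- vx :- vy :+ two :* ν :* vy :- two :* ν :* vy :- two :* (vb :* δ)
                  :+ (D :+ ν :+ two :* t :* f) :* vy :+ (two :* δ :- D :- ν :- two :* t :* f) :* vx)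
               refl (δ i j) (D i j) (n ⁻¹) t (φ b) (m ⁻¹) (sum v) (v b) (v x) (v y) (𝓔 v φ²) ⟩
        residual i - ι 2 * n ⁻¹ * w i y - ι 2 * (w i b * δ i j)
          + (D i j + n ⁻¹ + ι 2 * t * φ b) * w i y + (ι 2 * δ i j - D i j - n ⁻¹ - ι 2 * t * φ b) * w i x ∎
        where
        v = w i
        S = m ⁻¹ * sum v
        f₁ f₂ : Vector ℚ m
        f₁ a = δ i j * r a b + (1ℚ - δ i j) * σ a + 0ℚ
        f₂ a = (κ i j + ι 2 * t * φ b) * φ a + (- t) * φ² a + 0ℚ
        k = (1ℚ - δ i j) * σ b + ρ * q i j - κ i j * φ b - t * (φ b * φ b)

      -- Kirchhoff's current law at the glued vertices. After `B` is shifted by one copy, the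
      -- coefficients of `w i y` and `w (next i) x` belong to the same value, and by `D-next` they
      -- sum to zero. Only the source at `(j , b)` survives besides the residuals.
      ∑𝓔-Ψ : (∀ i → w i y ≡ w (next i) x) → ∀ j b → ∑[ i < n ] 𝓔 (w i) (λ a → Ψ i a j b) ≡ ∑[ i < n ] residual i - ι 2 * w j b
      ∑𝓔-Ψ w-glue j b = begin
        ∑[ i < n ] 𝓔 (w i) (λ a → Ψ i a j b)
          ≡⟨ trans (sum-cong-≗ λ i → 𝓔-Ψ i j b) (∑-distrib-+ A B) ⟩
        ∑[ i < n ] A i + ∑[ i < n ] B i
          ≡⟨ cong (_+_ (∑[ i < n ] A i)) (sym (∑-next B)) ⟩
        ∑[ i < n ] A i + ∑[ i < n ] B (next i)
          ≡⟨ sym (∑-distrib-+ A (B ∘ next)) ⟩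
        ∑[ i < n ] (A i + B (next i))
          ≡⟨ sum-cong-≗ cancel ⟩
        ∑[ i < n ] (1ℚ * residual i + (- ι 2) * (w i b * δ i j))
          ≡⟨ ∑-lin 1ℚ (- ι 2) residual (λ i → w i b * δ i j) ⟩
        1ℚ * ∑[ i < n ] residual i + (- ι 2) * ∑[ i < n ] (w i b * δ i j)
          ≡⟨ cong (λ z → 1ℚ * ∑[ i < n ] residual i + (- ι 2) * z) (∑-𝟙ʳ j (λ i → w i b)) ⟩
        1ℚ * ∑[ i < n ] residual i + (- ι 2) * w j b
          ≡⟨ solve 2 (λ s z → con 1ℚ :* s :+ con (- ι 2) :* z := s :- con (ι 2) :* z) refl (∑[ i < n ] residual i) (w j b) ⟩
        ∑[ i < n ] residual i - ι 2 * w j b ∎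
        where
        A B : Vector ℚ n
        A i = residual i - ι 2 * n ⁻¹ * w i y - ι 2 * (w i b * δ i j) + (D i j + n ⁻¹ + ι 2 * t * φ b) * w i y
        B i = (ι 2 * δ i j - D i j - n ⁻¹ - ι 2 * t * φ b) * w i x
        cancel : ∀ i → A i + B (next i) ≡ 1ℚ * residual i + (- ι 2) * (w i b * δ i j)
        cancel i = trans (cong (λ z → A i + (ι 2 * δ (next i) j - D (next i) j - n ⁻¹ - ι 2 * t * φ b) * z) (sym (w-glue i)))
          (modulo (w i y) (D-next i j) (solve 8 (λ R ν e d d′ δ′ tf z → let two = con (ι 2) in
            R :- two :* ν :* z :- two :* e :+ (d :+ ν :+ tf) :* z :+ (two :* δ′ :- d′ :- ν :- tf) :* z :=
            con 1ℚ :* R :+ con (- ι 2) :* e :+ z :* (d :- d′ :- two :* (ν :- δ′)))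
            refl (residual i) (n ⁻¹) (w i b * δ i j) (D i j) (D (next i) j) (δ (next i) j) (ι 2 * t * φ b) (w i y)))

    -- The matrix on the glued vertices and its Laplace equation

    N : ℕ
    N = n ℕ.* ℕ.pred m

    copy : Fin N → Fin n
    copy v = proj₁ (vertex-surjective y v)

    position : Fin N → Fin m
    position v = proj₁ (proj₂ (vertex-surjective y v))

    glue-copy-position : ∀ v → glue (copy v , position v) ≡ v
    glue-copy-position v with vertex-surjective y v
    ... | i , a , p , eq = trans (glue-vertex p) eq

    R : Matrix N N
    R u v = Ψ (copy u) (position u) (copy v) (position v)

    -- `copy` and `position` pick a representative whose position is not `y`, whereas `laplacian-F`
    -- evaluates at every position of every copy; `Ψ-glue` reconciles the two.
    R-glue : ∀ i a v → R (glue (i , a)) v ≡ Ψ i a (copy v) (position v)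
    R-glue i a v = helper (glued (copy u) (position u) i a (glue-copy-position u))
      where
      u = glue (i , a)
      helper : ∀ {j b} → Glued j b i a → Ψ j b (copy v) (position v) ≡ Ψ i a (copy v) (position v)
      helper (same refl refl)    = refl
      helper (yx refl refl refl) = Ψ-glue _ (copy v) (position v)
      helper (xy refl refl refl) = sym (Ψ-glue i (copy v) (position v))

    module _ (u : Fin N) where
      w : Fin n → Vector ℚ m
      w i a = 𝟙 (glue (i , a) Fin.≟ u)

      w-glue : ∀ i → w i y ≡ w (next i) x
      w-glue i = cong (λ s → 𝟙 (s Fin.≟ u)) (glue-y i)

      τ : ℚ
      τ = ∑[ i < n ] residual w i

      laplacian-R : ∀ v → (laplacian F *ᵥ (λ s → R s v)) u ≡ τ - ι 2 * 𝟙 (v Fin.≟ u)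
      laplacian-R v = begin
        (laplacian F *ᵥ (λ s → R s v)) u
          ≡⟨ laplacian-F (λ s → R s v) u ⟩
        ∑[ i < n ] 𝓔 (w i) (λ a → R (glue (i , a)) v)
          ≡⟨ sum-cong-≗ (λ i → 𝓔-congʳ (w i) (λ a → R-glue i a v)) ⟩
        ∑[ i < n ] 𝓔 (w i) (λ a → Ψ i a (copy v) (position v))
          ≡⟨ ∑𝓔-Ψ w w-glue (copy v) (position v) ⟩
        τ - ι 2 * w (copy v) (position v)
          ≡⟨ cong (λ s → τ - ι 2 * 𝟙 (s Fin.≟ u)) (glue-copy-position v) ⟩
        τ - ι 2 * 𝟙 (v Fin.≟ u) ∎

    Kf≡½∑∑R : Kf F ≡ ½ * (∑[ u < N ] ∑[ v < N ] R u v)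
    Kf≡½∑∑R = Kf≡½∑∑ F R τ (λ v → Ψ-diag (copy v) (position v)) laplacian-R

    -- The sum of all entries

    A M′ : ℚ
    A = + 1 / 6 * (ι m * ι m - 1ℚ)
    M′ = ι m - 1ℚ

    ∑∖-r : ∀ a → ∑∖ y (r a) ≡ A - r a y
    ∑∖-r a = cong (_- r a y) (trans (sum-cong-≗ (r-sym a)) (∑-r a))

    ∑∖∑∖-r : ∑∖ y (λ a → ∑∖ y (r a)) ≡ ι m * A - A - A
    ∑∖∑∖-r = begin
      ∑∖ y (λ a → ∑∖ y (r a))
        ≡⟨ ∑∖-cong y ∑∖-r ⟩
      ∑[ a < m ] (A - r a y) - (A - r y y)
        ≡⟨ cong₂ (λ u v → u - (A - v)) (trans (∑-distrib-- (λ _ → A) (λ a → r a y)) (cong₂ _-_ (∑-const m A) (∑-r y))) (r-diag y) ⟩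
      ι m * A - A - (A - 0ℚ)
        ≡⟨ solve 2 (λ m a → m :* a :- a :- (a :- con 0ℚ) := m :* a :- a :- a) refl (ι m) A ⟩
      ι m * A - A - A ∎

    ∑-affine : ∀ α β k → ∑[ a < m ] (α * r a x + β * r a y + k) ≡ α * A + β * A + ι m * k
    ∑-affine α β k = trans (∑-distrib-+ (λ a → α * r a x + β * r a y) (λ _ → k)) (cong₂ _+_
      (trans (∑-lin α β (λ a → r a x) (λ a → r a y)) (cong₂ (λ u v → α * u + β * v) (∑-r x) (∑-r y))) (∑-const m k))

    ∑∖-σ : ∑∖ y σ ≡ A - ½ * (ι m * ρ)
    ∑∖-σ = trans (cong₂ _-_ (∑-affine ½ ½ (- (½ * ρ))) σ-y)
      (solve 3 (λ a m ρ → con ½ :* a :+ con ½ :* a :+ m :* (:- (con ½ :* ρ)) :- con 0ℚ := a :- con ½ :* (m :* ρ)) refl A (ι m) ρ)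

    ∑∖-φ : ∑∖ y φ ≡ ½ * (ι m * ρ) - ρ
    ∑∖-φ = trans (cong₂ _-_ (∑-affine ½ (- ½) (½ * ρ)) φ-y)
      (solve 3 (λ a m ρ → con ½ :* a :+ con (- ½) :* a :+ m :* (con ½ :* ρ) :- ρ := con ½ :* (m :* ρ) :- ρ) refl A (ι m) ρ)

    -- `φ` is half of `r a x - r a y + ρ`. In its square the mixed term sums to zero, since all row
    -- sums of `r` agree, and the pure square is `∑-r-diff²`.
    ∑∖-φ² : ∑∖ y φ² ≡ + 1 / 4 * (+ 1 / 3 * (ι m * (ρ * ρ) + ι 2 * ρ) + ι m * (ρ * ρ)) - ρ * ρ
    ∑∖-φ² = cong₂ _-_ (begin
      ∑[ a < m ] φ² a
        ≡⟨ sum-cong-≗ (λ a → solve 3 (λ p q ρ →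
             (con ½ :* p :+ con (- ½) :* q :+ con ½ :* ρ) :* (con ½ :* p :+ con (- ½) :* q :+ con ½ :* ρ) :=
             con (+ 1 / 4) :* ((p :- q) :* (p :- q))
             :+ con (+ 1 / 4) :* (con (ι 2) :* ρ :* p :+ (:- (con (ι 2) :* ρ)) :* q :+ ρ :* ρ)) refl (r a x) (r a y) ρ) ⟩
      ∑[ a < m ] (+ 1 / 4 * ((r a x - r a y) * (r a x - r a y)) + + 1 / 4 * (ι 2 * ρ * r a x + (- (ι 2 * ρ)) * r a y + ρ * ρ))
        ≡⟨ ∑-lin (+ 1 / 4) (+ 1 / 4) (λ a → (r a x - r a y) * (r a x - r a y)) (λ a → ι 2 * ρ * r a x + (- (ι 2 * ρ)) * r a y + ρ * ρ) ⟩
      + 1 / 4 * ∑[ a < m ] ((r a x - r a y) * (r a x - r a y)) + + 1 / 4 * ∑[ a < m ] (ι 2 * ρ * r a x + (- (ι 2 * ρ)) * r a y + ρ * ρ)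
        ≡⟨ cong₂ (λ u v → + 1 / 4 * u + + 1 / 4 * v) (∑-r-diff² x y) (∑-affine (ι 2 * ρ) (- (ι 2 * ρ)) (ρ * ρ)) ⟩
      + 1 / 4 * (+ 1 / 3 * (ι m * (ρ * ρ) + ι 2 * ρ)) + + 1 / 4 * (ι 2 * ρ * A + (- (ι 2 * ρ)) * A + ι m * (ρ * ρ))
        ≡⟨ solve 4 (λ g a m ρ → con (+ 1 / 4) :* g :+ con (+ 1 / 4) :* (con (ι 2) :* ρ :* a :+ (:- (con (ι 2) :* ρ)) :* a :+ m :* (ρ :* ρ))
             := con (+ 1 / 4) :* (g :+ m :* (ρ :* ρ))) refl (+ 1 / 3 * (ι m * (ρ * ρ) + ι 2 * ρ)) A (ι m) ρ ⟩
      + 1 / 4 * (+ 1 / 3 * (ι m * (ρ * ρ) + ι 2 * ρ) + ι m * (ρ * ρ)) ∎)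
      (cong₂ _*_ φ-y φ-y)

    Σσ Σφ Σφ² P K Q : ℚ
    Σσ = ∑∖ y σ
    Σφ = ∑∖ y φ
    Σφ² = ∑∖ y φ²
    P = ι m * A - A - A - ι 2 * M′ * Σσ
    K = ι 2 * M′ * Σσ + ι 2 * t * (Σφ * Σφ) - ι 2 * M′ * t * Σφ²
    Q = M′ * M′ * ρ

    -- `κ` disappears because it multiplies `φ a - φ b`, which is antisymmetric. What is left
    -- depends on the copies only through `δ` and `q`.
    ∑∖∑∖-Ψ : ∀ i j → ∑∖ y (λ a → ∑∖ y (Ψ i a j)) ≡ δ i j * P + (1ℚ * K + Q * q i j)
    ∑∖∑∖-Ψ i j = begin
      ∑∖ y (λ a → ∑∖ y (Ψ i a j))
        ≡⟨ ∑∖-cong y inner ⟩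
      ∑∖ y (λ a → d * ∑∖ y (r a) + M′ * (1ℚ - d) * σ a + ((ι 2 * t * Σφ + M′ * k) * φ a + (- (M′ * t)) * φ² a) + c)
        ≡⟨ ∑∖-lin y d (M′ * (1ℚ - d)) (ι 2 * t * Σφ + M′ * k) (- (M′ * t)) c (λ a → ∑∖ y (r a)) σ φ φ² ⟩
      d * ∑∖ y (λ a → ∑∖ y (r a)) + M′ * (1ℚ - d) * Σσ + ((ι 2 * t * Σφ + M′ * k) * Σφ + (- (M′ * t)) * Σφ²) + M′ * c
        ≡⟨ cong (λ z → d * z + M′ * (1ℚ - d) * Σσ + ((ι 2 * t * Σφ + M′ * k) * Σφ + (- (M′ * t)) * Σφ²) + M′ * c) ∑∖∑∖-r ⟩
      d * (ι m * A - A - A) + M′ * (1ℚ - d) * Σσ + ((ι 2 * t * Σφ + M′ * k) * Σφ + (- (M′ * t)) * Σφ²) + M′ * c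
        ≡⟨ solve 10 (λ d RR M′ σ t φ k φ² ρ q →
             d :* RR :+ M′ :* (con 1ℚ :- d) :* σ :+ ((con (ι 2) :* t :* φ :+ M′ :* k) :* φ :+ (:- (M′ :* t)) :* φ²)
             :+ M′ :* ((con 1ℚ :- d) :* σ :- k :* φ :- t :* φ² :+ M′ :* (ρ :* q)) :=
             d :* (RR :- con (ι 2) :* M′ :* σ) :+ (con 1ℚ :* (con (ι 2) :* M′ :* σ :+ con (ι 2) :* t :* (φ :* φ) :- con (ι 2) :* M′ :* t :* φ²) :+ M′ :* M′ :* ρ :* q))
             refl d (ι m * A - A - A) M′ Σσ t Σφ k Σφ² ρ (q i j) ⟩
      d * P + (1ℚ * K + Q * q i j) ∎
      where
      d k c : ℚ
      d = δ i j
      k = κ i j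
      c = (1ℚ - d) * Σσ - k * Σφ - t * Σφ² + M′ * (ρ * q i j)
      inner : ∀ a → ∑∖ y (Ψ i a j) ≡
        d * ∑∖ y (r a) + M′ * (1ℚ - d) * σ a + ((ι 2 * t * Σφ + M′ * k) * φ a + (- (M′ * t)) * φ² a) + c
      inner a = begin
        ∑∖ y (Ψ i a j)
          ≡⟨ ∑∖-cong y (λ b → solve 9 (λ d k ρq t r σₐ σ φₐ f →
               d :* (r :- σₐ :- σ) :+ σₐ :+ σ :+ ρq :+ k :* (φₐ :- f) :- t :* ((φₐ :- f) :* (φₐ :- f)) :=
               d :* r :+ (con 1ℚ :- d) :* σ :+ ((con (ι 2) :* t :* φₐ :- k) :* f :+ (:- t) :* (f :* f))
               :+ ((con 1ℚ :- d) :* σₐ :+ ρq :+ k :* φₐ :- t :* (φₐ :* φₐ)))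
               refl d k (ρ * q i j) t (r a b) (σ a) (σ b) (φ a) (φ b)) ⟩
        ∑∖ y (λ b → d * r a b + (1ℚ - d) * σ b + ((ι 2 * t * φ a - k) * φ b + (- t) * φ² b) + c′)
          ≡⟨ ∑∖-lin y d (1ℚ - d) (ι 2 * t * φ a - k) (- t) c′ (r a) σ φ φ² ⟩
        d * ∑∖ y (r a) + (1ℚ - d) * Σσ + ((ι 2 * t * φ a - k) * Σφ + (- t) * Σφ²) + M′ * c′
          ≡⟨ solve 11 (λ d RR M′ Σσ t Σφ k Σφ² ρq σₐ φₐ →
               d :* RR :+ (con 1ℚ :- d) :* Σσ :+ ((con (ι 2) :* t :* φₐ :- k) :* Σφ :+ (:- t) :* Σφ²)
               :+ M′ :* ((con 1ℚ :- d) :* σₐ :+ ρq :+ k :* φₐ :- t :* (φₐ :* φₐ)) :=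
               d :* RR :+ M′ :* (con 1ℚ :- d) :* σₐ :+ ((con (ι 2) :* t :* Σφ :+ M′ :* k) :* φₐ :+ (:- (M′ :* t)) :* (φₐ :* φₐ))
               :+ ((con 1ℚ :- d) :* Σσ :- k :* Σφ :- t :* Σφ² :+ M′ :* ρq))
               refl d (∑∖ y (r a)) M′ Σσ t Σφ k Σφ² (ρ * q i j) (σ a) (φ a) ⟩
        d * ∑∖ y (r a) + M′ * (1ℚ - d) * σ a + ((ι 2 * t * Σφ + M′ * k) * φ a + (- (M′ * t)) * φ² a) + c ∎
        where
        c′ : ℚ
        c′ = (1ℚ - d) * σ a + ρ * q i j + k * φ a - t * (φ a * φ a)

    coordinates-vertex : ∀ i a (p : y ≢ a) → (copy (vertex i a p) , position (vertex i a p)) ≡ (i , a)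
    coordinates-vertex i a p = let _ , _ , p′ , eq = vertex-surjective y (vertex i a p) in vertex-injective p′ p eq

    ∑∑R : ∑[ u < N ] ∑[ v < N ] R u v ≡ ι n * (P + (ι n * K + Q * (+ 1 / 6 * (ι n * ι n - 1ℚ))))
    ∑∑R = begin
      ∑[ u < N ] ∑[ v < N ] R u v
        ≡⟨ sum-cong-≗ (λ u → ∑-vertices y (R u) (Ψ (copy u) (position u)) λ j b p → cong (λ s → Ψ (copy u) (position u) (proj₁ s) (proj₂ s)) (coordinates-vertex j b p)) ⟩
      ∑[ u < N ] ∑[ j < n ] ∑∖ y (Ψ (copy u) (position u) j)
        ≡⟨ ∑-vertices y _ (λ i a → ∑[ j < n ] ∑∖ y (Ψ i a j))
             (λ i a p → sum-cong-≗ λ j → ∑∖-cong y λ b → cong (λ s → Ψ (proj₁ s) (proj₂ s) j b) (coordinates-vertex i a p)) ⟩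
      ∑[ i < n ] ∑∖ y (λ a → ∑[ j < n ] ∑∖ y (Ψ i a j))
        ≡⟨ sum-cong-≗ (λ i → trans (∑∖-∑ y (λ a j → ∑∖ y (Ψ i a j))) (sum-cong-≗ (∑∖∑∖-Ψ i))) ⟩
      ∑[ i < n ] ∑[ j < n ] (δ i j * P + (1ℚ * K + Q * q i j))
        ≡⟨ sum-cong-≗ row ⟩
      ∑[ i < n ] (P + (ι n * K + Q * (+ 1 / 6 * (ι n * ι n - 1ℚ))))
        ≡⟨ ∑-const n _ ⟩
      ι n * (P + (ι n * K + Q * (+ 1 / 6 * (ι n * ι n - 1ℚ)))) ∎
      where
      row : ∀ i → ∑[ j < n ] (δ i j * P + (1ℚ * K + Q * q i j)) ≡ P + (ι n * K + Q * (+ 1 / 6 * (ι n * ι n - 1ℚ)))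
      row i = trans (∑-distrib-+ (λ j → δ i j * P) (λ j → 1ℚ * K + Q * q i j)) (cong₂ _+_ (∑-𝟙 i (λ _ → P))
        (trans (∑-lin 1ℚ Q (λ _ → K) (q i)) (cong₂ (λ u v → u + Q * v)
          (trans (ℚ.*-identityˡ _) (∑-const n K))
          (trans (sum-cong-≗ (CycleResistance.r-sym n i)) (CycleForm.∑-r n i)))))

    Kf-F : Kf F ≡ + 1 / 12 * (ι n * ρ * (ι n * ι n * (M′ * M′) + ι m * ι m * (ι 4 - ι 6 * ι n) + ι 6 * ι m * ι n - 1ℚ))
                - + 1 / 12 * (ι n * (ι m * (ι m * ι m) + ι m - ι 2 - ι 2 * ι n * (M′ * M′) * (ι m + 1ℚ)))
    Kf-F = begin
      Kf F
        ≡⟨ trans Kf≡½∑∑R (cong (½ *_) ∑∑R) ⟩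
      ½ * (ι n * (P + (ι n * K + Q * (+ 1 / 6 * (ι n * ι n - 1ℚ)))))
        ≡⟨ cong₂ (λ s f → total s f Σφ²) ∑∖-σ ∑∖-φ ⟩
      total (A - ½ * (ι m * ρ)) (½ * (ι m * ρ) - ρ) Σφ²
        ≡⟨ cong (total (A - ½ * (ι m * ρ)) (½ * (ι m * ρ) - ρ)) ∑∖-φ² ⟩
      total (A - ½ * (ι m * ρ)) (½ * (ι m * ρ) - ρ) (+ 1 / 4 * (+ 1 / 3 * (ι m * (ρ * ρ) + ι 2 * ρ) + ι m * (ρ * ρ)) - ρ * ρ)
        ≡⟨ Kf-algebra (ι m) (ι n) ρ (n ⁻¹) ρ⁻¹ (*-inverse n) ρρ⁻¹≡1 ⟩
      _ ∎
      where
      -- Abstracts the three sums so that their closed forms can be substituted separately.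
      total : ℚ → ℚ → ℚ → ℚ
      total s f f² = ½ * (ι n * (ι m * A - A - A - ι 2 * M′ * s
        + (ι n * (ι 2 * M′ * s + ι 2 * t * (f * f) - ι 2 * M′ * t * f²) + Q * (+ 1 / 6 * (ι n * ι n - 1ℚ)))))

  -- Distances in the cycle

  module _ (m : ℕ) (3≤m : 3 ℕ.≤ m) where
    open Graph (cycle m 3≤m) using (Adj; sym-Adj)

    gap : Fin m → Fin m → ℕ
    gap u v = ℕ.∣ toℕ u - toℕ v ∣

    snoc : ∀ {u v w k} → Walk (cycle m 3≤m) u v k → Adj v w → Walk (cycle m 3≤m) u w (suc k)
    snoc []       e = e ∷ []
    snoc (f ∷ ws) e = f ∷ snoc ws e

    reverse : ∀ {u v k} → Walk (cycle m 3≤m) u v k → Walk (cycle m 3≤m) v u k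
    reverse []       = []
    reverse (e ∷ ws) = snoc (reverse ws) (sym-Adj {x = _} {y = _} e)

    walk-up : ∀ k u v → toℕ u ℕ.+ k ≡ toℕ v → Walk (cycle m 3≤m) u v k
    walk-up zero    u v eq with Fin.toℕ-injective {i = u} {j = v} (trans (sym (ℕ.+-identityʳ (toℕ u))) eq)
    ... | refl = []
    walk-up (suc k) u v eq with nextView u
    ... | step _ p = inj₁ refl ∷ walk-up k (next u) v (trans (cong (ℕ._+ k) p) (trans (sym (ℕ.+-suc (toℕ u) k)) eq))
    ... | wrap p _ = contradiction (Fin.toℕ<n v) (ℕ.≤⇒≯ (subst (m ℕ.≤_) (trans (sym (ℕ.+-suc (toℕ u) k)) eq)
                       (subst (ℕ._≤ suc (toℕ u) ℕ.+ k) p (ℕ.m≤m+n (suc (toℕ u)) k))))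

    -- The target is regarded as `m + toℕ v`, one lap ahead. After the wrap the remaining walk is an
    -- ordinary ascent from 0.
    walk-around : ∀ k u v → toℕ u ℕ.+ k ≡ m ℕ.+ toℕ v → Walk (cycle m 3≤m) u v k
    walk-around zero    u v eq = contradiction (Fin.toℕ<n u)
      (ℕ.≤⇒≯ (subst (m ℕ.≤_) (trans (sym eq) (ℕ.+-identityʳ (toℕ u))) (ℕ.m≤m+n m (toℕ v))))
    walk-around (suc k) u v eq with nextView u
    ... | step _ p = inj₁ refl ∷ walk-around k (next u) v (trans (cong (ℕ._+ k) p) (trans (sym (ℕ.+-suc (toℕ u) k)) eq))
    ... | wrap p q = inj₁ refl ∷ walk-up k (next u) v (trans (cong (ℕ._+ k) q)
            (ℕ.+-cancelˡ-≡ m k (toℕ v) (trans (cong (ℕ._+ k) (sym p)) (trans (sym (ℕ.+-suc (toℕ u) k)) eq))))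

    gap<m : ∀ u v → gap u v ℕ.< m
    gap<m u v = ℕ.≤-<-trans (ℕ.∣m-n∣≤m⊔n (toℕ u) (toℕ v)) (ℕ.⊔-lub (Fin.toℕ<n u) (Fin.toℕ<n v))

    walks-≤ : ∀ u v → toℕ u ℕ.≤ toℕ v →
              Walk (cycle m 3≤m) u v (gap u v) × Walk (cycle m 3≤m) v u (m ℕ.∸ gap u v)
    walks-≤ u v u≤v = walk-up (gap u v) u v u+d≡v , walk-around (m ℕ.∸ gap u v) v u (begin
      toℕ v ℕ.+ (m ℕ.∸ gap u v)                  ≡⟨ cong (ℕ._+ (m ℕ.∸ gap u v)) (sym u+d≡v) ⟩
      toℕ u ℕ.+ gap u v ℕ.+ (m ℕ.∸ gap u v)      ≡⟨ ℕ.+-assoc (toℕ u) (gap u v) _ ⟩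
      toℕ u ℕ.+ (gap u v ℕ.+ (m ℕ.∸ gap u v))    ≡⟨ cong (toℕ u ℕ.+_) (ℕ.m+[n∸m]≡n (ℕ.<⇒≤ (gap<m u v))) ⟩
      toℕ u ℕ.+ m                                ≡⟨ ℕ.+-comm (toℕ u) m ⟩
      m ℕ.+ toℕ u                                ∎)
      where
      u+d≡v : toℕ u ℕ.+ gap u v ≡ toℕ v
      u+d≡v = trans (cong (toℕ u ℕ.+_) (ℕ.m≤n⇒∣m-n∣≡n∸m u≤v)) (ℕ.m+[n∸m]≡n u≤v)

    walks : ∀ u v → Walk (cycle m 3≤m) u v (gap u v) × Walk (cycle m 3≤m) u v (m ℕ.∸ gap u v)
    walks u v with ℕ.≤-total (toℕ u) (toℕ v)
    ... | inj₁ u≤v = let short , long = walks-≤ u v u≤v in short , reverse long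
    ... | inj₂ v≤u = let short , long = walks-≤ v u v≤u in
      subst (Walk (cycle m 3≤m) u v) (ℕ.∣-∣-comm (toℕ v) (toℕ u)) (reverse short) ,
      subst (λ d → Walk (cycle m 3≤m) u v (m ℕ.∸ d)) (ℕ.∣-∣-comm (toℕ v) (toℕ u)) long

    -- An edge changes the gap d to some w by at most one, except that the edge from m - 1 to 0 replaces d by m - 1 - d.
    gap-step : ∀ {d d′ k} → (d ℕ.≤ suc d′ × d′ ℕ.≤ suc d) ⊎ suc (d ℕ.+ d′) ≡ m →
               d′ ℕ.≤ k ⊎ m ℕ.≤ k ℕ.+ d′ → d ℕ.≤ suc k ⊎ m ℕ.≤ suc k ℕ.+ d
    gap-step (inj₁ (d≤ , _)) (inj₁ d′≤k) = inj₁ (ℕ.≤-trans d≤ (ℕ.s≤s d′≤k))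
    gap-step {d} {d′} {k} (inj₁ (_ , d′≤)) (inj₂ m≤) =
      inj₂ (ℕ.≤-trans m≤ (ℕ.≤-trans (ℕ.+-monoʳ-≤ k d′≤) (ℕ.≤-reflexive (ℕ.+-suc k d))))
    gap-step {d} {d′} {k} (inj₂ eq) (inj₁ d′≤k) = inj₂ (subst (ℕ._≤ suc k ℕ.+ d) (trans (cong suc (ℕ.+-comm d′ d)) eq)
      (ℕ.s≤s (ℕ.+-monoˡ-≤ d d′≤k)))
    gap-step {d} {d′} {k} (inj₂ refl) (inj₂ m≤) = inj₁ (ℕ.m≤n⇒m≤1+n (ℕ.<⇒≤ (ℕ.+-cancelʳ-≤ d′ (suc d) k m≤)))

    gap-next : ∀ u w → (gap u w ℕ.≤ suc (gap (next u) w) × gap (next u) w ℕ.≤ suc (gap u w)) ⊎ suc (gap u w ℕ.+ gap (next u) w) ≡ m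
    gap-next u w with nextView u
    ... | step _ p = inj₁
      ( ℕ.≤-trans (ℕ.∣-∣-triangle (toℕ u) (toℕ (next u)) (toℕ w)) (ℕ.+-monoˡ-≤ (gap (next u) w) (ℕ.≤-reflexive 1≡))
      , ℕ.≤-trans (ℕ.∣-∣-triangle (toℕ (next u)) (toℕ u) (toℕ w))
          (ℕ.+-monoˡ-≤ (gap u w) (ℕ.≤-reflexive (trans (ℕ.∣-∣-comm (toℕ (next u)) (toℕ u)) 1≡))) )
      where
      1≡ : gap u (next u) ≡ 1
      1≡ = trans (cong (ℕ.∣ toℕ u -_∣) (trans p (ℕ.+-comm 1 (toℕ u)))) (ℕ.∣m-m+n∣≡n (toℕ u) 1)
    ... | wrap p q = inj₂ (begin
      suc (gap u w ℕ.+ gap (next u) w)            ≡⟨ cong₂ (λ a b → suc (a ℕ.+ ℕ.∣ b - toℕ w ∣)) (ℕ.m≤n⇒∣n-m∣≡n∸m w≤u) q ⟩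
      suc (toℕ u ℕ.∸ toℕ w ℕ.+ toℕ w)             ≡⟨ cong suc (ℕ.m∸n+n≡m w≤u) ⟩
      suc (toℕ u)                                 ≡⟨ p ⟩
      m                                           ∎)
      where
      w≤u : toℕ w ℕ.≤ toℕ u
      w≤u = ℕ.s≤s⁻¹ (subst (toℕ w ℕ.<_) (sym p) (Fin.toℕ<n w))

    -- A walk covers either the gap or its complement in the cycle. A backward edge is a forward
    -- edge seen from its other end, so the bounds of `gap-next` are reused with their sides
    -- exchanged.
    walk-bound : ∀ {u v k} → Walk (cycle m 3≤m) u v k → gap u v ℕ.≤ k ⊎ m ℕ.≤ k ℕ.+ gap u v
    walk-bound {u} [] = inj₁ (ℕ.≤-reflexive (ℕ.∣n-n∣≡0 (toℕ u)))
    walk-bound {u} {v} (inj₁ refl ∷ ws) = gap-step (gap-next u v) (walk-bound ws)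
    walk-bound {u} {v} (_∷_ {v = u′} (inj₂ refl) ws) = gap-step (flip (gap-next u′ v)) (walk-bound ws)
      where
      flip : ∀ {d d′} → (d ℕ.≤ suc d′ × d′ ℕ.≤ suc d) ⊎ suc (d ℕ.+ d′) ≡ m → (d′ ℕ.≤ suc d × d ℕ.≤ suc d′) ⊎ suc (d′ ℕ.+ d) ≡ m
      flip (inj₁ (a , b))        = inj₁ (b , a)
      flip {d} {d′} (inj₂ eq)    = inj₂ (trans (cong suc (ℕ.+-comm d′ d)) eq)

    -- Which alternative is the smaller is left undecided: `p m - p²` is invariant under
    -- `p ↦ m - p`, so both give the same resistance.
    distance-gap : ∀ {u v p} → IsDistance (cycle m 3≤m) u v p → p ≡ gap u v ⊎ p ≡ m ℕ.∸ gap u v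
    distance-gap {u} {v} {p} (ws , minimal) with walk-bound ws
    ... | inj₁ d≤p = inj₁ (ℕ.≤-antisym (minimal _ (proj₁ (walks u v))) d≤p)
    ... | inj₂ m≤p+d = inj₂ (ℕ.≤-antisym (minimal _ (proj₂ (walks u v)))
      (ℕ.m≤n+o⇒m∸n≤o m (gap u v) (subst (m ℕ.≤_) (ℕ.+-comm p (gap u v)) m≤p+d)))

    module _ .{{_ : ℕ.NonZero m}} where
      open CycleResistance m using (r)

      ι-∸gap : ∀ u v → ι (m ℕ.∸ gap u v) ≡ ι m - ι (gap u v)
      ι-∸gap u v = begin
        ι (m ℕ.∸ d)               ≡⟨ solve 2 (λ k d → k := k :+ d :- d) refl (ι (m ℕ.∸ d)) (ι d) ⟩
        ι (m ℕ.∸ d) + ι d - ι d   ≡⟨ cong (_- ι d) (trans (sym (ι-+ (m ℕ.∸ d) d)) (cong ι (ℕ.m∸n+n≡m (ℕ.<⇒≤ (gap<m u v))))) ⟩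
        ι m - ι d                 ∎
        where d = gap u v

      m*r≡pm-p² : ∀ {u v p} → IsDistance (cycle m 3≤m) u v p → ι m * r u v ≡ ι p * ι m - ι p * ι p
      m*r≡pm-p² {u} {v} dist with distance-gap dist
      ... | inj₁ refl = modulo (- (d * d)) (*-inverse m) (solve 3 (λ m d ν →
              m :* (d :- d :* d :* ν) := d :* m :- d :* d :+ (:- (d :* d)) :* (m :* ν :- con 1ℚ)) refl (ι m) d (m ⁻¹))
        where d = ι (gap u v)
      ... | inj₂ refl = trans (modulo (- (d * d)) (*-inverse m) (solve 3 (λ m d ν →
              m :* (d :- d :* d :* ν) := (m :- d) :* m :- (m :- d) :* (m :- d) :+ (:- (d :* d)) :* (m :* ν :- con 1ℚ)) refl (ι m) d (m ⁻¹)))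
              (cong (λ z → z * ι m - z * z) (sym (ι-∸gap u v)))
        where d = ι (gap u v)

      -- The two arcs of lengths `d` and `e = m - d` are in parallel, so the resistance is
      -- `d e / m`. Both lengths are positive for distinct vertices, and the witness is the
      -- reciprocal `m / (d e)`.
      r-invertible : ∀ {u v} → u ≢ v → ∃ λ s → r u v * s ≡ 1ℚ
      r-invertible {u} {v} u≢v = ι m * (d ⁻¹) * (e ⁻¹) ,
        modulo (ι d * d ⁻¹ * (ι e * e ⁻¹)) (*-inverse m)
        (modulo (ι e * e ⁻¹) (*-inverse d) (modulo 1ℚ (*-inverse e)
        (trans (cong (_* (ι m * d ⁻¹ * e ⁻¹)) factored) (solve 6 (λ m μ d δ e ε →
          d :* e :* μ :* (m :* δ :* ε) := con 1ℚ :+ d :* δ :* (e :* ε) :* (m :* μ :- con 1ℚ)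
          :+ e :* ε :* (d :* δ :- con 1ℚ) :+ con 1ℚ :* (e :* ε :- con 1ℚ)) refl (ι m) (m ⁻¹) (ι d) (d ⁻¹) (ι e) (e ⁻¹)))))
        where
        d e : ℕ
        d = gap u v
        e = m ℕ.∸ gap u v
        instance
          d≢0 : ℕ.NonZero d
          d≢0 = ℕ.≢-nonZero (λ d≡0 → u≢v (Fin.toℕ-injective (ℕ.∣m-n∣≡0⇒m≡n d≡0)))
          e≢0 : ℕ.NonZero e
          e≢0 = ℕ.>-nonZero (ℕ.m<n⇒0<n∸m (gap<m u v))
        factored : r u v ≡ ι d * ι e * m ⁻¹
        factored = trans (modulo (- ι d) (*-inverse m) (solve 3 (λ d m ν →
               d :- d :* d :* ν := d :* (m :- d) :* ν :+ (:- d) :* (m :* ν :- con 1ℚ)) refl (ι d) (ι m) (m ⁻¹)))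
             (cong (λ z → ι d * z * m ⁻¹) (sym (ι-∸gap u v)))

  -- From integer numerators to rational expressions

  infix 4 _↦_
  infixl 6 _⊕_ _⊖_
  infixl 7 _⊛_

  -- A data type instead of the bare equation, so that unification can read off `i` and `q` from the
  -- type while derivations are built along the shape of an expression.
  data _↦_ (i : ℤ) (q : ℚ) : Set where
    cast : ℤ→ℚ i ≡ q → i ↦ q

  _⊕_ : ∀ {i j p q} → i ↦ p → j ↦ q → i ℤ.+ j ↦ p + q
  _⊕_ {i} {j} (cast a) (cast b) = cast (trans (ℤ→ℚ-+ i j) (cong₂ _+_ a b))

  _⊖_ : ∀ {i j p q} → i ↦ p → j ↦ q → i ℤ.- j ↦ p - q
  _⊖_ {i} {j} (cast a) (cast b) = cast (trans (ℤ→ℚ-+ i (ℤ.- j)) (cong₂ _+_ a (trans (ℤ→ℚ-neg j) (cong -_ b))))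

  _⊛_ : ∀ {i j p q} → i ↦ p → j ↦ q → i ℤ.* j ↦ p * q
  _⊛_ {i} {j} (cast a) (cast b) = cast (trans (ℤ→ℚ-* i j) (cong₂ _*_ a b))

  square : ∀ {i p} → i ↦ p → i ℤ.^ 2 ↦ p * p
  -- `i ^ 2` unfolds to `i * (i * + 1)`; the trailing unit is removed on the rational side.
  square {i} {p} c with c ⊛ (c ⊛ cast {+ 1} refl)
  ... | cast eq = cast (trans eq (cong (p *_) (ℚ.*-identityʳ p)))

  cube : ∀ {i p} → i ↦ p → i ℤ.^ 3 ↦ p * (p * p)
  cube c = c ⊛ square c

  ι↦ : ∀ k → + k ↦ ι k
  ι↦ k = cast refl

  -- Characterises `a / d` by multiplying with `d`, which avoids computing with the normalised
  -- fraction.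
  /-unique : ∀ {a p} z d .{{_ : ℕ.NonZero d}} → a ↦ p → z * ι d ≡ p → a / d ≡ z
  /-unique {a} {p} z d (cast a≡p) zd≡p = begin
    a / d                 ≡⟨ modulo (- (a / d)) (*-inverse d) (solve 3 (λ q d δ → q := q :* d :* δ :+ (:- q) :* (d :* δ :- con 1ℚ)) refl (a / d) (ι d) (d ⁻¹)) ⟩
    a / d * ι d * d ⁻¹    ≡⟨ cong (_* d ⁻¹) (trans (/-* a d) (trans a≡p (sym zd≡p))) ⟩
    z * ι d * d ⁻¹        ≡⟨ modulo z (*-inverse d) (solve 3 (λ z d δ → z :* d :* δ := z :+ z :* (d :* δ :- con 1ℚ)) refl z (ι d) (d ⁻¹)) ⟩
    z                     ∎

  -- The numerators `a` and `b` are known only through their rational images, so that all algebra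
  -- takes place in ℚ and the integer form is attached at the end.
  Kf-sunflower : (m n : ℕ) (3≤m : 3 ℕ.≤ m) (3≤n : 3 ℕ.≤ n) (x y : Fin m) (x≢y : x ≢ y)
    (p : ℕ) → IsDistance (cycle m 3≤m) x y p → .{{_ : ℕ.NonZero (12 ℕ.* m)}} → ∀ {a b} →
    a ↦ ι n * (ι p * ι m - ι p * ι p) *
        (ι n * ι n * ((ι m - 1ℚ) * (ι m - 1ℚ)) + ι m * ι m * (ι 4 - ι 6 * ι n) + ι 6 * ι m * ι n - 1ℚ) →
    b ↦ ι n * (ι m * (ι m * ι m) + ι m - ι 2 - ι 2 * ι n * ((ι m - 1ℚ) * (ι m - 1ℚ)) * (ι m + 1ℚ)) →
    Kf (sunflower m n 3≤m 3≤n x y x≢y) ≡ a / (12 ℕ.* m) - b / 12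
  Kf-sunflower m n 3≤m 3≤n x y x≢y p dist a↦ b↦ = trans Kf-F (sym (cong₂ _-_
    (/-unique (+ 1 / 12 * (ι n * ρ * K)) (12 ℕ.* m) a↦ scaled)
    (/-unique (+ 1 / 12 * B) 12 b↦ (solve 1 (λ b → con (+ 1 / 12) :* b :* con (ι 12) := b) refl B))))
    where
    instance
      m≢0 : ℕ.NonZero m
      m≢0 = ℕ.>-nonZero (ℕ.≤-trans (ℕ.s≤s ℕ.z≤n) 3≤m)
      n≢0 : ℕ.NonZero n
      n≢0 = ℕ.>-nonZero (ℕ.≤-trans (ℕ.s≤s ℕ.z≤n) 3≤n)
    open SunflowerPotential m n 3≤m 3≤n x y x≢y
      (proj₁ (r-invertible m 3≤m x≢y)) (proj₂ (r-invertible m 3≤m x≢y)) using (Kf-F)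
    ρ K B : ℚ
    ρ = CycleResistance.r m x y
    K = ι n * ι n * ((ι m - 1ℚ) * (ι m - 1ℚ)) + ι m * ι m * (ι 4 - ι 6 * ι n) + ι 6 * ι m * ι n - 1ℚ
    B = ι n * (ι m * (ι m * ι m) + ι m - ι 2 - ι 2 * ι n * ((ι m - 1ℚ) * (ι m - 1ℚ)) * (ι m + 1ℚ))
    -- The factor `m` of the denominator comes from `ρ`, since `m ρ = p m - p²`.
    scaled : + 1 / 12 * (ι n * ρ * K) * ι (12 ℕ.* m) ≡ ι n * (ι p * ι m - ι p * ι p) * K
    scaled = begin
      + 1 / 12 * (ι n * ρ * K) * ι (12 ℕ.* m)
        ≡⟨ cong (+ 1 / 12 * (ι n * ρ * K) *_) (ι-* 12 m) ⟩
      + 1 / 12 * (ι n * ρ * K) * (ι 12 * ι m)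
        ≡⟨ solve 4 (λ n ρ k m → con (+ 1 / 12) :* (n :* ρ :* k) :* (con (ι 12) :* m) := n :* (m :* ρ) :* k) refl (ι n) ρ K (ι m) ⟩
      ι n * (ι m * ρ) * K
        ≡⟨ cong (λ z → ι n * z * K) (m*r≡pm-p² m 3≤m dist) ⟩
      ι n * (ι p * ι m - ι p * ι p) * K ∎

open import Data.Fin using (Fin)
open import Data.Integer using (+_; _+_; _-_; _*_; _^_)
open import Data.Nat as ℕ using (ℕ)
open import Data.Rational as ℚ using (_/_)
open import Relation.Binary.PropositionalEquality using (_≡_; _≢_)
open KirchhoffIndex using (Kf-sunflower; ι↦; _⊕_; _⊖_; _⊛_; square; cube)

theorem5p4 :
    (m n : ℕ) (3≤m : 3 ℕ.≤ m) (3≤n : 3 ℕ.≤ n) (x y : Fin m) (x≢y : x ≢ y)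
    (p : ℕ) → IsDistance (cycle m 3≤m) x y p →
    let M = + m
        N = + n
        P = + p
        instance _ = 12*m≢0 3≤m
    in Kf (sunflower m n 3≤m 3≤n x y x≢y) ≡
       (N * (P * M - P ^ 2) *
         (N ^ 2 * (M - + 1) ^ 2 + M ^ 2 * (+ 4 - + 6 * N) + + 6 * M * N - + 1))
         / (12 ℕ.* m)
       ℚ.-
       (N * (M ^ 3 + M - + 2 - + 2 * N * (M - + 1) ^ 2 * (M + + 1))) / 12
theorem5p4 m n 3≤m 3≤n x y x≢y p dist = Kf-sunflower m n 3≤m 3≤n x y x≢y p dist {{12*m≢0 3≤m}}
  -- Both derivations copy the shape of the integer numerators operator by operator.
  (N ⊛ (P ⊛ M ⊖ square P) ⊛
    (square N ⊛ square (M ⊖ ι↦ 1) ⊕ square M ⊛ (ι↦ 4 ⊖ ι↦ 6 ⊛ N) ⊕ ι↦ 6 ⊛ M ⊛ N ⊖ ι↦ 1))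
  (N ⊛ (cube M ⊕ M ⊖ ι↦ 2 ⊖ ι↦ 2 ⊛ N ⊛ square (M ⊖ ι↦ 1) ⊛ (M ⊕ ι↦ 1)))
  where
  M = ι↦ m
  N = ι↦ n
  P = ι↦ p
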